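{- For every integer $i\ge 1$, the sequence $\{\sqrt[n]{d_i(i+n)}\}_{n\ge 1}$ is strictly log-convex; that is, for all integers $i\ge 1$ and $n\ge 1$, $$\frac{\sqrt[n+1]{d_i(i+n+1)}}{\sqrt[n]{d_i(i+n)}}<\frac{\sqrt[n+2]{d_i(i+n+2)}}{\sqrt[n+1]{d_i(i+n+1)}}.$$
   Context: For integers $m\ge 0$ and $0\le i\le m$, the Boros–Moll numbers are $$d_i(m)=2^{ -2m}\sum_{k=i}^{m}2^k\binom{2m-2k}{m-k}\binom{m+k}{k}\binom{k}{i}.$$ -}

module Defs where

open import Algebra.Definitions.RawSemiring using ()
open import Data.Empty using (⊥; ⊥-elim)
open import Data.Integer.Base as ℤ using ()
import Data.Integer.Properties as ℤ
open import Data.List.Base using (map; upTo)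
open import Data.Nat.Base as ℕ using (ℕ; zero; suc; NonZero)
open import Data.Nat.Combinatorics using (_C_; nCk+nC[k+1]≡[n+1]C[k+1])
open import Data.Nat.Coprimality as Coprimality using (1-coprimeTo)
open import Data.Nat.ListAction using (sum)
import Data.Nat.Properties as ℕ
open import Data.Product.Base using (_×_; _,_; proj₁; proj₂; ∃; ∃-syntax)
open import Data.Rational.Base hiding (NonZero)
open import Data.Rational.Properties
open import Data.Sum.Base as Sum using (_⊎_; inj₁; inj₂)
open import Relation.Binary.PropositionalEquality
open import Relation.Nullary using (yes; no)

open Algebra.Definitions.RawSemiring +-*-rawSemiring public using (_^_)
open Algebra.Definitions.RawSemiring +-*-rawSemiring using () renaming (_×_ to _·_)

------------------------------------------------------------------------
-- Boros–Moll numbers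

-- The list of j with 0 ≤ j < suc m ∸ i runs over the summation indices
-- k = i + j with i ≤ k ≤ m.  For these k the subtractions are exact.

dTerm : ℕ → ℕ → ℕ → ℕ
dTerm i m k = 2 ℕ.^ k ℕ.* ((2 ℕ.* m ℕ.∸ 2 ℕ.* k) C (m ℕ.∸ k)) ℕ.* ((m ℕ.+ k) C k) ℕ.* (k C i)

dSum : ℕ → ℕ → ℕ
dSum i m = sum (map (λ j → dTerm i m (i ℕ.+ j)) (upTo (suc m ℕ.∸ i)))

d : ℕ → ℕ → ℚ
d i m = (ℤ.+ dSum i m) / (2 ℕ.^ (2 ℕ.* m))
  where instance _ = ℕ.m^n≢0 2 (2 ℕ.* m)

0<nCk : ∀ n k → k ℕ.≤ n → 0 ℕ.< n C k
0<nCk n       zero    _             = ℕ.s≤s ℕ.z≤n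
0<nCk (suc n) (suc k) (ℕ.s≤s k≤n) =
  subst (0 ℕ.<_) (nCk+nC[k+1]≡[n+1]C[k+1] n k)
    (ℕ.<-≤-trans (0<nCk n k k≤n) (ℕ.m≤m+n (n C k) (n C suc k)))

0<dSum : ∀ {i m} → i ℕ.≤ m → 0 ℕ.< dSum i m
0<dSum {i} {m} i≤m rewrite ℕ.+-∸-assoc 1 i≤m | ℕ.+-identityʳ i =
  ℕ.<-≤-trans
    (mul (mul (mul (ℕ.m^n>0 2 i) (0<nCk (2 ℕ.* m ℕ.∸ 2 ℕ.* i) (m ℕ.∸ i) le))
              (0<nCk (m ℕ.+ i) i (ℕ.m≤n+m i m)))
         (0<nCk i i ℕ.≤-refl))
    (ℕ.m≤m+n _ _)
  where
  mul : ∀ {a b} → 0 ℕ.< a → 0 ℕ.< b → 0 ℕ.< a ℕ.* b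
  mul = ℕ.*-mono-<
  le : m ℕ.∸ i ℕ.≤ 2 ℕ.* m ℕ.∸ 2 ℕ.* i
  le = subst (m ℕ.∸ i ℕ.≤_) (ℕ.*-distribˡ-∸ 2 m i) (ℕ.m≤m+n (m ℕ.∸ i) _)

0<d : ∀ {i m} → i ℕ.≤ m → 0ℚ < d i m
0<d {i} {m} i≤m = positive⁻¹ (d i m) {{normalize-pos (dSum i m) (2 ℕ.^ (2 ℕ.* m))}}
  where instance
    _ = ℕ.m^n≢0 2 (2 ℕ.* m)
    _ = ℕ.>-nonZero (0<dSum i≤m)

------------------------------------------------------------------------
-- Arithmetic of positive rationals

0<*0< : ∀ {p q} → 0ℚ < p → 0ℚ < q → 0ℚ < p * q
0<*0< {p} {q} 0<p 0<q = positive⁻¹ (p * q) {{pos*pos⇒pos p {{positive 0<p}} q {{positive 0<q}}}}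

*-monoˡ-< : ∀ {p q r} → 0ℚ < r → p < q → p * r < q * r
*-monoˡ-< {r = r} 0<r = *-monoˡ-<-pos r {{positive 0<r}}

*-monoʳ-< : ∀ {p q r} → 0ℚ < r → p < q → r * p < r * q
*-monoʳ-< {r = r} 0<r = *-monoʳ-<-pos r {{positive 0<r}}

*-mono-≤-0< : ∀ {p q r s} → 0ℚ < r → 0ℚ < q → p ≤ q → r ≤ s → p * r ≤ q * s
*-mono-≤-0< {p} {q} {r} {s} 0<r 0<q p≤q r≤s = ≤-trans
  (*-monoʳ-≤-nonNeg r {{pos⇒nonNeg r {{positive 0<r}}}} p≤q)
  (*-monoˡ-≤-nonNeg q {{pos⇒nonNeg q {{positive 0<q}}}} r≤s)

*-cancelʳ-< : ∀ {p q r} → 0ℚ < r → p * r < q * r → p < q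
*-cancelʳ-< {r = r} 0<r = *-cancelʳ-<-nonNeg r {{pos⇒nonNeg r {{positive 0<r}}}}

0<-cancelʳ : ∀ {p r} → 0ℚ < r → 0ℚ < p * r → 0ℚ < p
0<-cancelʳ {p} {r} 0<r 0<pr = *-cancelʳ-< 0<r (subst (_< p * r) (sym (*-zeroˡ r)) 0<pr)

quotient : ∀ r {s} → 0ℚ < s → ∃[ t ] t * s ≡ r
quotient r {s} 0<s = r * 1/ s , trans (*-assoc r (1/ s) s)
    (trans (cong (r *_) (*-inverseˡ s)) (*-identityʳ r))
  where instance _ = pos⇒nonZero s {{positive 0<s}}

p<p+q : ∀ p {q} → 0ℚ < q → p < p + q
p<p+q p {q} 0<q = subst (_< p + q) (+-identityʳ p) (+-monoʳ-< p 0<q)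

^-pos : ∀ n {q} → 0ℚ < q → 0ℚ < q ^ n
^-pos zero    0<q = positive⁻¹ 1ℚ
^-pos (suc n) 0<q = 0<*0< 0<q (^-pos n 0<q)

^-mono-≤ : ∀ n {p q} → 0ℚ < p → p ≤ q → p ^ n ≤ q ^ n
^-mono-≤ zero    0<p p≤q = ≤-refl
^-mono-≤ (suc n) 0<p p≤q =
  *-mono-≤-0< (^-pos n 0<p) (<-≤-trans 0<p p≤q) p≤q (^-mono-≤ n 0<p p≤q)

^-mono-< : ∀ n .{{_ : NonZero n}} {p q} → 0ℚ < p → p < q → p ^ n < q ^ n
^-mono-< (suc n) 0<p p<q = <-≤-trans
  (*-monoˡ-< (^-pos n 0<p) p<q)
  (*-mono-≤-0< (^-pos n 0<p) (<-trans 0<p p<q) ≤-refl (^-mono-≤ n 0<p (<⇒≤ p<q)))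

1^n≡1 : ∀ n → 1ℚ ^ n ≡ 1ℚ
1^n≡1 zero    = refl
1^n≡1 (suc n) = trans (*-identityˡ _) (1^n≡1 n)

q≤1⇒q^n≤q : ∀ n .{{_ : NonZero n}} {q} → 0ℚ < q → q ≤ 1ℚ → q ^ n ≤ q
q≤1⇒q^n≤q (suc n) {q} 0<q q≤1 = subst (q ^ suc n ≤_) (*-identityʳ q)
  (*-mono-≤-0< (^-pos n 0<q) 0<q ≤-refl
    (subst (q ^ n ≤_) (1^n≡1 n) (^-mono-≤ n 0<q q≤1)))

1≤q⇒q≤q^n : ∀ n .{{_ : NonZero n}} {q} → 1ℚ ≤ q → q ≤ q ^ n
1≤q⇒q≤q^n (suc n) {q} 1≤q = subst (_≤ q ^ suc n) (*-identityʳ q)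
  (*-mono-≤-0< 0<1 (<-≤-trans 0<1 1≤q) ≤-refl
    (subst (_≤ q ^ n) (1^n≡1 n) (^-mono-≤ n 0<1 1≤q)))
  where 0<1 = positive⁻¹ 1ℚ

^-gap-above : ∀ n {q r} → 0ℚ < q → q ^ n < r → ∃[ q′ ] q < q′ × q′ ^ n < r
^-gap-above zero    {q} _ 1<r = q + 1ℚ , p<p+q q (positive⁻¹ 1ℚ) , 1<r
^-gap-above (suc n) {q} {r} 0<q q^<r
  with quotient r (^-pos n 0<q)
... | t , refl with <-dense (*-cancelʳ-< {q} {t} (^-pos n 0<q) q^<r)
... | q₂ , q<q₂ , q₂<t with quotient (t * q ^ n) (<-trans 0<q q<q₂)
... | s , sq₂≡r
  with ^-gap-above n {q} {s} 0<q (*-cancelʳ-< 0<q₂ (subst₂ _<_ (*-comm q₂ (q ^ n)) (sym sq₂≡r) (*-monoˡ-< {q₂} {t} (^-pos n 0<q) q₂<t)))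
  where 0<q₂ = <-trans 0<q q<q₂
... | q₁ , q<q₁ , q₁^<s = pick (≤-total q₁ q₂)
  where
  0<q₁ = <-trans 0<q q<q₁
  0<q₂ = <-trans 0<q q<q₂
  bound : ∀ {q′} → q < q′ → q′ ≤ q₁ → q′ ≤ q₂ → q′ ^ suc n < t * q ^ n
  bound q<q′ ≤₁ ≤₂ = ≤-<-trans
    (*-mono-≤-0< (^-pos n 0<q′) 0<q₂ ≤₂ (^-mono-≤ n 0<q′ ≤₁))
    (subst (q₂ * q₁ ^ n <_) (trans (*-comm q₂ s) sq₂≡r) (*-monoʳ-< 0<q₂ q₁^<s))
    where 0<q′ = <-trans 0<q q<q′
  pick : q₁ ≤ q₂ ⊎ q₂ ≤ q₁ → ∃[ q′ ] q < q′ × q′ ^ suc n < t * q ^ n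
  pick (inj₁ le) = q₁ , q<q₁ , bound q<q₁ ≤-refl le
  pick (inj₂ le) = q₂ , q<q₂ , bound q<q₂ le ≤-refl

^-gap-below : ∀ n {q r} → 0ℚ < q → 0ℚ < r → r < q ^ n →
              ∃[ q′ ] 0ℚ < q′ × q′ < q × r < q′ ^ n
^-gap-below zero 0<q _ r<1 with <-dense 0<q
... | q′ , 0<q′ , q′<q = q′ , 0<q′ , q′<q , r<1
^-gap-below (suc n) {q} {r} 0<q 0<r r<q^
  with quotient r (^-pos n 0<q)
... | t , refl with <-dense (*-cancelʳ-< {t} {q} (^-pos n 0<q) r<q^)
... | q₂ , t<q₂ , q₂<q with <-trans (0<-cancelʳ {t} (^-pos n 0<q) 0<r) t<q₂
... | 0<q₂ with quotient (t * q ^ n) 0<q₂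
... | s , sq₂≡r
  with ^-gap-below n {q} {s} 0<q (0<-cancelʳ 0<q₂ (subst (0ℚ <_) (sym sq₂≡r) 0<r))
         (*-cancelʳ-< 0<q₂ (subst₂ _<_ (sym sq₂≡r) (*-comm q₂ (q ^ n)) (*-monoˡ-< {t} {q₂} (^-pos n 0<q) t<q₂)))
... | q₁ , 0<q₁ , q₁<q , s<q₁^ = pick (≤-total q₁ q₂)
  where
  bound : ∀ {q′} → q₁ ≤ q′ → q₂ ≤ q′ → t * q ^ n < q′ ^ suc n
  bound ≤₁ ≤₂ = <-≤-trans
    (subst (_< q₂ * q₁ ^ n) (trans (*-comm q₂ s) sq₂≡r) (*-monoʳ-< 0<q₂ s<q₁^))
    (*-mono-≤-0< (^-pos n 0<q₁) (<-≤-trans 0<q₁ ≤₁) ≤₂ (^-mono-≤ n 0<q₁ ≤₁))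
  pick : q₁ ≤ q₂ ⊎ q₂ ≤ q₁ → ∃[ q′ ] 0ℚ < q′ × q′ < q × t * q ^ n < q′ ^ suc n
  pick (inj₁ le) = q₂ , 0<q₂ , q₂<q , bound le ≤-refl
  pick (inj₂ le) = q₁ , 0<q₁ , q₁<q , bound ≤-refl le

fromℕ : ℕ → ℚ
fromℕ n = mkℚ (ℤ.+ n) 0 (Coprimality.sym (1-coprimeTo n))

fromℕ-suc : ∀ n → fromℕ (suc n) ≡ 1ℚ + fromℕ n
fromℕ-suc n = trans (sym (↥p/↧p≡p (fromℕ (suc n))))
  (/-cong {q₁ = 1} {q₂ = 1} (cong (λ z → ℤ.+ 1 ℤ.+ z) (sym (ℤ.*-identityʳ (ℤ.+ n)))) refl)

fromℕ-* : ∀ n p → fromℕ n * p ≡ n · p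
fromℕ-* zero    p = *-zeroˡ p
fromℕ-* (suc n) p = trans (cong (_* p) (fromℕ-suc n))
  (trans (*-distribʳ-+ p 1ℚ (fromℕ n)) (cong₂ _+_ (*-identityˡ p) (fromℕ-* n p)))

≤fromℕ : ∀ p → ∃[ n ] p ≤ fromℕ n
≤fromℕ p@(mkℚ (ℤ.+ n) b _) = n , *≤* (ℤ.*-monoˡ-≤-nonNeg (ℤ.+ n) (ℤ.+≤+ (ℕ.s≤s ℕ.z≤n)))
≤fromℕ p@(mkℚ (ℤ.-[1+ _ ]) b _) = 0 , *≤* ℤ.-≤+

archimedean : ∀ p {q} → 0ℚ < q → ∃[ n ] p ≤ n · q
archimedean p {q} 0<q with quotient p 0<q
... | t , refl with ≤fromℕ t
... | n , t≤n = n , subst (t * q ≤_) (fromℕ-* n q)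
  (*-monoʳ-≤-nonNeg q {{pos⇒nonNeg q {{positive 0<q}}}} t≤n)

------------------------------------------------------------------------
-- Positive real numbers, as two-sided Dedekind cuts of the positive
-- rationals: L q means q < x, U q means x < q.

record ℝ⁺ : Set₁ where
  field
    L U      : ℚ → Set
    L-pos    : ∀ {q} → L q → 0ℚ < q
    L-inh    : ∃ L
    U-inh    : ∃ U
    L-down   : ∀ {p q} → 0ℚ < p → p < q → L q → L p
    U-up     : ∀ {p q} → p < q → U p → U q
    L-open   : ∀ {p} → L p → ∃[ q ] p < q × L q
    U-open   : ∀ {q} → U q → ∃[ p ] p < q × U p
    disjoint : ∀ {q} → L q → U q → ⊥
    located  : ∀ {p q} → 0ℚ < p → p < q → L p ⊎ U q

  L<U : ∀ {p q} → L p → U q → p < q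
  L<U {p} {q} Lp Uq with p <? q
  ... | yes p<q = p<q
  ... | no  p≮q with U-open Uq
  ...   | r , r<q , Ur = ⊥-elim (disjoint Lp (U-up (<-≤-trans r<q (≮⇒≥ p≮q)) Ur))

  U-pos : ∀ {q} → U q → 0ℚ < q
  U-pos Uq = <-trans (L-pos (proj₂ L-inh)) (L<U (proj₂ L-inh) Uq)

  march : ∀ {δ} n {s} → 0ℚ < δ → L s → U (s + n · δ) →
          ∃[ s′ ] s ≤ s′ × L s′ × U ((s′ + δ) + δ)
  march zero    {s} 0<δ Ls Us = ⊥-elim (disjoint Ls (subst U (+-identityʳ s) Us))
  march {δ} (suc n) {s} 0<δ Ls Us
    with located (<-trans (L-pos Ls) (p<p+q s 0<δ)) (p<p+q (s + δ) 0<δ)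
  ... | inj₂ U+ = s , ≤-refl , Ls , U+
  ... | inj₁ L+ with march n 0<δ L+ (subst U (sym (+-assoc s δ (n · δ))) Us)
  ...   | s′ , le , Ls′ , Us′ = s′ , ≤-trans (<⇒≤ (p<p+q s 0<δ)) le , Ls′ , Us′

  approximate : ∀ {p q} → 0ℚ < p → p < q → ∃[ s ] ∃[ t ] L s × U t × p * t < q * s
  approximate {p} {q} 0<p p<q with L-inh | U-inh
  ... | s₀ , Ls₀ | t₀ , Ut₀ with quotient (q * s₀) 0<p
  ... | w , wp≡qs₀ with <-dense (*-cancelʳ-< {s₀} {w} 0<p
        (subst₂ _<_ (*-comm p s₀) (sym wp≡qs₀) (*-monoˡ-< (L-pos Ls₀) p<q)))
  ... | v , s₀<v , v<w with quotient (v - s₀) {1ℚ + 1ℚ} (positive⁻¹ (1ℚ + 1ℚ))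
  ... | δ , δ2≡v-s₀ = result
    where
    δ+δ≡v-s₀ : δ + δ ≡ v - s₀
    δ+δ≡v-s₀ = trans (sym (trans (*-distribˡ-+ δ 1ℚ 1ℚ) (cong₂ _+_ (*-identityʳ δ) (*-identityʳ δ)))) δ2≡v-s₀

    0<v-s₀ : 0ℚ < v - s₀
    0<v-s₀ = subst (_< v - s₀) (+-inverseʳ s₀) (+-monoˡ-< (- s₀) s₀<v)

    0<δ : 0ℚ < δ
    0<δ = 0<-cancelʳ {δ} {1ℚ + 1ℚ} (positive⁻¹ (1ℚ + 1ℚ)) (subst (0ℚ <_) (sym δ2≡v-s₀) 0<v-s₀)

    s₀+2δ≡v : s₀ + (δ + δ) ≡ v
    s₀+2δ≡v = trans (cong (s₀ +_) δ+δ≡v-s₀) (trans (+-comm s₀ (v - s₀))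
      (trans (+-assoc v (- s₀) s₀) (trans (cong (v +_) (+-inverseˡ s₀)) (+-identityʳ v))))

    close : p * (s₀ + (δ + δ)) < q * s₀
    close = subst₂ _<_ (trans (*-comm v p) (cong (p *_) (sym s₀+2δ≡v))) wp≡qs₀ (*-monoˡ-< 0<p v<w)

    closer : ∀ {s} → s₀ ≤ s → p * ((s + δ) + δ) < q * s
    closer {s} s₀≤s = subst₂ _<_ lhs rhs (+-mono-<-≤ close
        (*-monoʳ-≤-nonNeg (s - s₀) {{nonNegative 0≤e}} (<⇒≤ p<q)))
      where
      0≤e : 0ℚ ≤ s - s₀
      0≤e = subst (_≤ s - s₀) (+-inverseʳ s₀) (+-monoˡ-≤ (- s₀) s₀≤s)
      s₀+e≡s : s₀ + (s - s₀) ≡ s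
      s₀+e≡s = trans (+-comm s₀ (s - s₀)) (trans (+-assoc s (- s₀) s₀)
        (trans (cong (s +_) (+-inverseˡ s₀)) (+-identityʳ s)))
      rhs : q * s₀ + q * (s - s₀) ≡ q * s
      rhs = trans (sym (*-distribˡ-+ q s₀ (s - s₀))) (cong (q *_) s₀+e≡s)
      lhs : p * (s₀ + (δ + δ)) + p * (s - s₀) ≡ p * ((s + δ) + δ)
      lhs = trans (sym (*-distribˡ-+ p _ _)) (cong (p *_)
        (trans (+-assoc s₀ (δ + δ) (s - s₀))
        (trans (cong (s₀ +_) (+-comm (δ + δ) (s - s₀)))
        (trans (sym (+-assoc s₀ (s - s₀) (δ + δ)))
        (trans (cong (_+ (δ + δ)) s₀+e≡s) (sym (+-assoc s δ δ)))))))

    result : ∃[ s ] ∃[ t ] L s × U t × p * t < q * s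
    result with archimedean t₀ 0<δ
    ... | n , t₀≤nδ with march n 0<δ Ls₀ (U-up
            (≤-<-trans t₀≤nδ (subst (n · δ <_) (+-comm (n · δ) s₀) (p<p+q (n · δ) (L-pos Ls₀)))) Ut₀)
    ... | s , s₀≤s , Ls , Us = s , (s + δ) + δ , Ls , Us , closer s₀≤s

infix 4 _<ʳ_
_<ʳ_ : ℝ⁺ → ℝ⁺ → Set
x <ʳ y = ∃[ q ] ℝ⁺.U x q × ℝ⁺.L y q

fromℚ⁺ : (a : ℚ) → 0ℚ < a → ℝ⁺
fromℚ⁺ a 0<a = record
  { L        = λ q → 0ℚ < q × q < a
  ; U        = λ q → a < q
  ; L-pos    = proj₁
  ; L-inh    = <-dense 0<a
  ; U-inh    = a + 1ℚ , p<p+q a (positive⁻¹ 1ℚ)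
  ; L-down   = λ 0<p p<q (_ , q<a) → 0<p , <-trans p<q q<a
  ; U-up     = λ p<q a<p → <-trans a<p p<q
  ; L-open   = λ (0<p , p<a) → let q , p<q , q<a = <-dense p<a in q , p<q , <-trans 0<p p<q , q<a
  ; U-open   = λ a<q → let p , a<p , p<q = <-dense a<q in p , p<q , a<p
  ; disjoint = λ (_ , q<a) a<q → <-asym q<a a<q
  ; located  = loc
  }
  where
  loc : ∀ {p q} → 0ℚ < p → p < q → (0ℚ < p × p < a) ⊎ a < q
  loc {p} 0<p p<q with p <? a
  ... | yes p<a = inj₁ (0<p , p<a)
  ... | no  p≮a = inj₂ (≤-<-trans (≮⇒≥ p≮a) p<q)

-- q < ⁿ√x iff qⁿ < x, and ⁿ√x < q iff x < qⁿ, for q > 0.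

root : (n : ℕ) → .{{NonZero n}} → ℝ⁺ → ℝ⁺
root n x = record
  { L        = λ q → 0ℚ < q × L (q ^ n)
  ; U        = λ q → 0ℚ < q × U (q ^ n)
  ; L-pos    = proj₁
  ; L-inh    = linh
  ; U-inh    = uinh
  ; L-down   = λ 0<p p<q (_ , Lq) → 0<p , L-down (^-pos n 0<p) (^-mono-< n 0<p p<q) Lq
  ; U-up     = λ p<q (0<p , Up) → <-trans 0<p p<q , U-up (^-mono-< n 0<p p<q) Up
  ; L-open   = λ (0<p , Lp) →
      let r , p^<r , Lr = L-open Lp
          q , p<q , q^<r = ^-gap-above n 0<p p^<r
          0<q = <-trans 0<p p<q
      in q , p<q , 0<q , L-down (^-pos n 0<q) q^<r Lr
  ; U-open   = λ (0<q , Uq) →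
      let r , r<q^ , Ur = U-open Uq
          p , 0<p , p<q , r<p^ = ^-gap-below n 0<q (U-pos Ur) r<q^
      in p , p<q , 0<p , U-up r<p^ Ur
  ; disjoint = λ (_ , Lq) (_ , Uq) → disjoint Lq Uq
  ; located  = loc
  }
  where
  open ℝ⁺ x
  0<1 = positive⁻¹ 1ℚ

  L-down-≤ : ∀ {p q} → 0ℚ < p → p ≤ q → L q → L p
  L-down-≤ 0<p p≤q Lq = let r , q<r , Lr = L-open Lq in L-down 0<p (≤-<-trans p≤q q<r) Lr

  U-up-≤ : ∀ {p q} → p ≤ q → U p → U q
  U-up-≤ p≤q Up = let r , r<p , Ur = U-open Up in U-up (<-≤-trans r<p p≤q) Ur

  linh : ∃[ q ] 0ℚ < q × L (q ^ n)
  linh with L-inh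
  ... | r , Lr with ≤-total r 1ℚ
  ...   | inj₁ r≤1 = r , L-pos Lr , L-down-≤ (^-pos n (L-pos Lr)) (q≤1⇒q^n≤q n (L-pos Lr) r≤1) Lr
  ...   | inj₂ 1≤r = 1ℚ , 0<1 , subst L (sym (1^n≡1 n)) (L-down-≤ 0<1 1≤r Lr)

  uinh : ∃[ q ] 0ℚ < q × U (q ^ n)
  uinh with U-inh
  ... | r , Ur with ≤-total r 1ℚ
  ...   | inj₁ r≤1 = 1ℚ , 0<1 , subst U (sym (1^n≡1 n)) (U-up-≤ r≤1 Ur)
  ...   | inj₂ 1≤r = r , U-pos Ur , U-up-≤ (1≤q⇒q≤q^n n 1≤r) Ur

  loc : ∀ {p q} → 0ℚ < p → p < q → (0ℚ < p × L (p ^ n)) ⊎ (0ℚ < q × U (q ^ n))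
  loc 0<p p<q with located (^-pos n 0<p) (^-mono-< n 0<p p<q)
  ... | inj₁ Lp = inj₁ (0<p , Lp)
  ... | inj₂ Uq = inj₂ (<-trans 0<p p<q , Uq)

-- q < x / y iff q s < x for some s > y, and x / y < q iff x < q s for
-- some positive s < y.

infixl 7 _÷ʳ_
_÷ʳ_ : ℝ⁺ → ℝ⁺ → ℝ⁺
x ÷ʳ y = record
  { L        = λ q → 0ℚ < q × ∃[ s ] Y.U s × X.L (q * s)
  ; U        = λ q → ∃[ s ] Y.L s × X.U (q * s)
  ; L-pos    = proj₁
  ; L-inh    =
      let r , Lr = X.L-inh
          s , Us = Y.U-inh
          q , qs≡r = quotient r (Y.U-pos Us)
      in q , 0<-cancelʳ (Y.U-pos Us) (subst (0ℚ <_) (sym qs≡r) (X.L-pos Lr))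
           , s , Us , subst X.L (sym qs≡r) Lr
  ; U-inh    =
      let r , Ur = X.U-inh
          s , Ls = Y.L-inh
          q , qs≡r = quotient r (Y.L-pos Ls)
      in q , s , Ls , subst X.U (sym qs≡r) Ur
  ; L-down   = λ 0<p p<q (_ , s , Us , Lqs) →
      0<p , s , Us , X.L-down (0<*0< 0<p (Y.U-pos Us)) (*-monoˡ-< (Y.U-pos Us) p<q) Lqs
  ; U-up     = λ p<q (s , Ls , Ups) → s , Ls , X.U-up (*-monoˡ-< (Y.L-pos Ls) p<q) Ups
  ; L-open   = λ {p} (0<p , s , Us , Lps) →
      let r , ps<r , Lr = X.L-open Lps
          q , qs≡r = quotient r (Y.U-pos Us)
          p<q = *-cancelʳ-< (Y.U-pos Us) (subst (p * s <_) (sym qs≡r) ps<r)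
      in q , p<q , <-trans 0<p p<q , s , Us , subst X.L (sym qs≡r) Lr
  ; U-open   = λ {q} (s , Ls , Uqs) →
      let r , r<qs , Ur = X.U-open Uqs
          p , ps≡r = quotient r (Y.L-pos Ls)
      in p , *-cancelʳ-< (Y.L-pos Ls) (subst (_< q * s) (sym ps≡r) r<qs)
           , s , Ls , subst X.U (sym ps≡r) Ur
  ; disjoint = λ (0<q , s , Us , Lqs) (s′ , Ls′ , Uqs′) →
      X.disjoint Lqs (X.U-up (*-monoʳ-< 0<q (Y.L<U Ls′ Us)) Uqs′)
  ; located  = loc
  }
  where
  module X = ℝ⁺ x
  module Y = ℝ⁺ y
  loc : ∀ {p q} → 0ℚ < p → p < q →
        (0ℚ < p × ∃[ s ] Y.U s × X.L (p * s)) ⊎ (∃[ s ] Y.L s × X.U (q * s))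
  loc {p} {q} 0<p p<q = split (Y.approximate 0<p p<q)
    where
    split : ∃[ s ] ∃[ t ] Y.L s × Y.U t × p * t < q * s →
            (0ℚ < p × ∃[ s ] Y.U s × X.L (p * s)) ⊎ (∃[ s ] Y.L s × X.U (q * s))
    split (s , t , Ls , Ut , pt<qs) =
      Sum.map (λ Lpt → 0<p , t , Ut , Lpt) (λ Uqs → s , Ls , Uqs)
        (X.located (0<*0< 0<p (Y.U-pos Ut)) pt<qs)

------------------------------------------------------------------------
-- Strict log-convexity of a sequence of positive reals indexed by n ≥ 1

StrictlyLogConvex : ((n : ℕ) → .{{NonZero n}} → ℝ⁺) → Set
StrictlyLogConvex a =
  ∀ n → .{{_ : NonZero n}} → a (1 ℕ.+ n) ÷ʳ a n <ʳ a (2 ℕ.+ n) ÷ʳ a (1 ℕ.+ n)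

{-# OPTIONS --safe #-}
module Submission where

-- Write m = i + n, x(n) = 4^m d_i(m) and v(n) for the same sum with each summand multiplied by
-- m − k.  Creative telescoping gives a first-order system expressing x(n+1) and v(n+1) through
-- x(n) and v(n) with positive coefficients.  By induction it yields i n x ≤ 2 (i² + 2 i + n) v.
-- Substituting 2 (i² + 2 i + n) v = i n x + u turns the difference of the two sides of
-- x(n) x(n+2)³ < x(n+3) x(n+1)³ into a polynomial in n, i − 1, x, u without negative coefficients.
-- So the ratios a(n+1) / a(n) of a(n) = d_i(i+n) are strictly log-convex.  The quantity
-- F(n) = log (a(n)^((n+1)(n+2)) a(n+2)^(n(n+1)) / a(n+1)^(2n(n+2))) then increases, because
-- F(n+1) − F(n) is (n+1)(n+2) times the second difference of the logarithms of the ratios,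
-- and F(0) = 2 log d_i(i) ≥ 0.

open import Data.Nat.Tactic.RingSolver using (solve-∀)
open import Data.Product.Base using (_×_; _,_; ∃-syntax)
open import Relation.Binary.PropositionalEquality

-- Integer inequalities for the sums 4^m d_i(m)

module Naturals where

  open import Data.Bool.Base using (Bool; true; false; _∧_; T)
  open import Data.Bool.Properties using (T-∧)
  open import Data.Fin.Base using (Fin; zero; suc)
  open import Data.List.Base using (List; []; _∷_; map; upTo; applyUpTo)
  open import Data.List.Properties using (map-applyUpTo)
  open import Data.Nat.Base
  open import Data.Nat.Combinatorics using (_C_; k![n∸k]!∣n!)
  open import Data.Nat.Combinatorics.Specification using (nCk≡n!/k![n-k]!)
  open import Data.Nat.DivMod using (m/n*n≡m)
  open import Data.Nat.ListAction using (sum)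
  open import Data.Nat.Properties
  open import Data.Vec.Base using (Vec; []; _∷_; lookup)
  open import Defs using (dTerm; dSum; 0<dSum; 0<nCk)
  open import Function.Base using (_∘_; id)
  open import Function.Bundles using (module Equivalence)

  -- Coefficientwise comparison of polynomials over ℕ

  -- Dense Horner form: a list holds the coefficients of the powers of the first variable, constant
  -- term first, each a polynomial in the remaining variables. Normalisation and comparison of
  -- closed expressions then run by evaluation.
  Poly : ℕ → Set
  Poly zero    = ℕ
  Poly (suc k) = List (Poly k)

  eval : ∀ {k} → Poly k → Vec ℕ k → ℕ
  eval {zero}  c       _       = c
  eval {suc k} []      _       = 0
  eval {suc k} (a ∷ f) (x ∷ ρ) = eval a ρ + x * eval f (x ∷ ρ)

  infixl 6 _⊕_
  infixl 7 _⊗_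

  _⊕_ : ∀ {k} → Poly k → Poly k → Poly k
  _⊕_ {zero}  a       b       = a + b
  _⊕_ {suc k} []      g       = g
  _⊕_ {suc k} (a ∷ f) []      = a ∷ f
  _⊕_ {suc k} (a ∷ f) (b ∷ g) = (a ⊕ b) ∷ (f ⊕ g)

  constant : ∀ k → ℕ → Poly k
  constant zero    c = c
  constant (suc k) c = constant k c ∷ []

  _⊗_ : ∀ {k} → Poly k → Poly k → Poly k
  scale : ∀ {k} → Poly k → Poly (suc k) → Poly (suc k)
  _⊗_ {zero}  a       b = a * b
  _⊗_ {suc k} []      g = []
  _⊗_ {suc k} (a ∷ f) g = scale a g ⊕ (constant k 0 ∷ (f ⊗ g))
  scale a []      = []
  scale a (b ∷ g) = (a ⊗ b) ∷ scale a g

  indeterminate : ∀ {k} → Fin k → Poly k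
  indeterminate {suc k} zero    = constant k 0 ∷ constant k 1 ∷ []
  indeterminate {suc k} (suc j) = indeterminate j ∷ []

  eval-⊕ : ∀ {k} (f g : Poly k) ρ → eval (f ⊕ g) ρ ≡ eval f ρ + eval g ρ
  eval-⊕ {zero}  a       b       _       = refl
  eval-⊕ {suc k} []      g       _       = refl
  eval-⊕ {suc k} (a ∷ f) []      (x ∷ ρ) = sym (+-identityʳ _)
  eval-⊕ {suc k} (a ∷ f) (b ∷ g) (x ∷ ρ)
    rewrite eval-⊕ a b ρ | eval-⊕ f g (x ∷ ρ) = lemma (eval a ρ) _ x _ _
    where
    lemma : ∀ a b x f g → (a + b) + x * (f + g) ≡ (a + x * f) + (b + x * g)
    lemma = solve-∀

  eval-constant : ∀ k c ρ → eval (constant k c) ρ ≡ c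
  eval-constant zero    c _       = refl
  eval-constant (suc k) c (x ∷ ρ) rewrite eval-constant k c ρ | *-zeroʳ x = +-identityʳ c

  eval-⊗ : ∀ {k} (f g : Poly k) ρ → eval (f ⊗ g) ρ ≡ eval f ρ * eval g ρ
  eval-scale : ∀ {k} (a : Poly k) g x ρ → eval (scale a g) (x ∷ ρ) ≡ eval a ρ * eval g (x ∷ ρ)
  eval-⊗ {zero}  a       b _ = refl
  eval-⊗ {suc k} []      g _ = refl
  eval-⊗ {suc k} (a ∷ f) g (x ∷ ρ)
    rewrite eval-⊕ (scale a g) (constant k 0 ∷ (f ⊗ g)) (x ∷ ρ) | eval-scale a g x ρ
          | eval-constant k 0 ρ | eval-⊗ f g (x ∷ ρ) = lemma (eval a ρ) x _ _
    where
    lemma : ∀ a x f g → a * g + x * (f * g) ≡ (a + x * f) * g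
    lemma = solve-∀
  eval-scale a []      x ρ = sym (*-zeroʳ (eval a ρ))
  eval-scale a (b ∷ g) x ρ rewrite eval-⊗ a b ρ | eval-scale a g x ρ = lemma (eval a ρ) _ x _
    where
    lemma : ∀ a b x g → a * b + x * (a * g) ≡ a * (b + x * g)
    lemma = solve-∀

  eval-indeterminate : ∀ {k} (j : Fin k) ρ → eval (indeterminate j) ρ ≡ lookup ρ j
  eval-indeterminate {suc k} zero (x ∷ ρ)
    rewrite eval-constant k 0 ρ | eval-constant k 1 ρ | *-zeroʳ x = *-identityʳ x
  eval-indeterminate {suc k} (suc j) (x ∷ ρ) rewrite *-zeroʳ x = trans (+-identityʳ _) (eval-indeterminate j ρ)

  -- Missing coefficients on the left count as 0. An excess coefficient on the left gives `false`
  -- even if it is 0, so the test is sound but not complete.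
  _≤ᶜ_ : ∀ {k} → Poly k → Poly k → Bool
  _≤ᶜ_ {zero}  a       b       = a ≤ᵇ b
  _≤ᶜ_ {suc k} []      g       = true
  _≤ᶜ_ {suc k} (a ∷ f) []      = false
  _≤ᶜ_ {suc k} (a ∷ f) (b ∷ g) = (a ≤ᶜ b) ∧ (f ≤ᶜ g)

  eval-mono : ∀ {k} (f g : Poly k) ρ → T (f ≤ᶜ g) → eval f ρ ≤ eval g ρ
  eval-mono {zero}  a       b       _       h = ≤ᵇ⇒≤ a b h
  eval-mono {suc k} []      g       _       h = z≤n
  eval-mono {suc k} (a ∷ f) (b ∷ g) (x ∷ ρ) h =
    let a≤b , f≤g = Equivalence.to (T-∧ {a ≤ᶜ b}) h
    in +-mono-≤ (eval-mono a b ρ a≤b) (*-monoʳ-≤ x (eval-mono f g (x ∷ ρ) f≤g))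

  infixl 6 _:+_
  infixl 7 _:*_

  data Expr (k : ℕ) : Set where
    var       : Fin k → Expr k
    con       : ℕ → Expr k
    _:+_ _:*_ : Expr k → Expr k → Expr k

  ⟦_⟧ : ∀ {k} → Expr k → Vec ℕ k → ℕ
  ⟦ var j ⟧  ρ = lookup ρ j
  ⟦ con c ⟧  ρ = c
  ⟦ e :+ f ⟧ ρ = ⟦ e ⟧ ρ + ⟦ f ⟧ ρ
  ⟦ e :* f ⟧ ρ = ⟦ e ⟧ ρ * ⟦ f ⟧ ρ

  normalise : ∀ {k} → Expr k → Poly k
  normalise (var j)  = indeterminate j
  normalise (con c)  = constant _ c
  normalise (e :+ f) = normalise e ⊕ normalise f
  normalise (e :* f) = normalise e ⊗ normalise f

  eval-normalise : ∀ {k} (e : Expr k) ρ → eval (normalise e) ρ ≡ ⟦ e ⟧ ρ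
  eval-normalise (var j)  ρ = eval-indeterminate j ρ
  eval-normalise (con c)  ρ = eval-constant _ c ρ
  eval-normalise (e :+ f) ρ rewrite eval-⊕ (normalise e) (normalise f) ρ =
    cong₂ _+_ (eval-normalise e ρ) (eval-normalise f ρ)
  eval-normalise (e :* f) ρ rewrite eval-⊗ (normalise e) (normalise f) ρ =
    cong₂ _*_ (eval-normalise e ρ) (eval-normalise f ρ)

  -- Monomials in natural numbers are nonnegative, so comparing coefficients suffices. For closed
  -- `e` and `f` the hypothesis reduces to the unit type and is filled in by `_`.
  dominated : ∀ {k} (e f : Expr k) → T (normalise e ≤ᶜ normalise f) → ∀ ρ → ⟦ e ⟧ ρ ≤ ⟦ f ⟧ ρ
  dominated e f h ρ = subst₂ _≤_ (eval-normalise e ρ) (eval-normalise f ρ)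
    (eval-mono (normalise e) (normalise f) ρ h)

  -- Ratio log-convexity from a first-order system

  -- The formulas are needed twice, over ℕ and as syntax for the polynomial comparison.
  module System {A : Set} (add mul : A → A → A) (‵ : ℕ → A) where
    infixl 6 _⊞_
    infixl 7 _⊠_
    _⊞_ _⊠_ : A → A → A
    _⊞_ = add
    _⊠_ = mul

    -- `massForm` and `momentForm` are the right sides of the recurrences for x and v with a factor
    -- 2 taken out; see `x-rec` and `v-rec`.
    massForm : A → A → A → A → A
    massForm n i x v = ((‵ 1 ⊞ (n ⊞ i)) ⊠ (‵ 4 ⊠ (n ⊞ i) ⊞ ‵ 3) ⊞ i) ⊠ x ⊞ ‵ 2 ⊠ i ⊠ v

    momentForm : A → A → A → A → A
    momentForm n i x v = (‵ 2 ⊠ i ⊞ ‵ 1) ⊠ x ⊞ (‵ 4 ⊠ (n ⊞ i) ⊞ ‵ 4 ⊠ i ⊞ ‵ 5) ⊠ v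

    weight : A → A → A
    weight n i = i ⊠ i ⊞ ‵ 2 ⊠ i ⊞ n

    -- If (x , v) are the values at n, then 2ᵏ yₖ / (a₁ ⋯ aₖ) and 2ᵏ zₖ / (a₁ ⋯ aₖ) are those at n + k.
    -- Clearing denominators turns x(n) x(n+2)³ < x(n+3) x(n+1)³ into lhs < rhs.
    module Iterates (n i x v : A) where
      y₁ z₁ y₂ z₂ y₃ a₁ a₂ a₃ lhs rhs : A
      y₁ = massForm n i x v
      z₁ = (‵ 1 ⊞ n) ⊠ momentForm n i x v
      y₂ = massForm (‵ 1 ⊞ n) i y₁ z₁
      z₂ = (‵ 2 ⊞ n) ⊠ momentForm (‵ 1 ⊞ n) i y₁ z₁
      y₃ = massForm (‵ 2 ⊞ n) i y₂ z₂
      a₁ = (‵ 1 ⊞ n) ⊠ (‵ 1 ⊞ (n ⊞ i))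
      a₂ = (‵ 2 ⊞ n) ⊠ (‵ 2 ⊞ (n ⊞ i))
      a₃ = (‵ 3 ⊞ n) ⊠ (‵ 3 ⊞ (n ⊞ i))
      lhs = x ⊠ (y₂ ⊠ (y₂ ⊠ y₂)) ⊠ (a₁ ⊠ a₃)
      rhs = y₃ ⊠ (y₁ ⊠ (y₁ ⊠ y₁)) ⊠ (a₂ ⊠ a₂)

  open System _+_ _*_ id
  module E = System (_:+_ {4}) _:*_ con

  -- The second variable stands for i - 1, so that the coefficient comparison takes place on the
  -- range i ≥ 1.
  nᵉ iᵉ xᵉ uᵉ : Expr 4
  nᵉ = var zero
  iᵉ = con 1 :+ var (suc zero)
  xᵉ = var (suc (suc zero))
  uᵉ = var (suc (suc (suc zero)))

  -- The pair (x, v) scaled by c = 2 (i² + 2 i + n). Writing c v as i n x + u turns the inequality i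
  -- n x ≤ c v into the nonnegativity of the variable u.
  Xᵉ Vᵉ : Expr 4
  Xᵉ = con 2 :* E.weight nᵉ iᵉ :* xᵉ
  Vᵉ = iᵉ :* nᵉ :* xᵉ :+ uᵉ

  module IE = E.Iterates nᵉ iᵉ Xᵉ Vᵉ

  -- The summand x⁴ is a margin: coefficientwise comparison gives only ≤, and x⁴ > 0 makes the
  -- inequality strict.
  lhs<rhs : ∀ n p x u → let i = suc p; X = 2 * weight n i * x; V = i * n * x + u in
    Iterates.lhs n i X V + x * x * (x * x) ≤ Iterates.rhs n i X V
  lhs<rhs n p x u = dominated (IE.lhs :+ xᵉ :* xᵉ :* (xᵉ :* xᵉ)) IE.rhs _ (n ∷ p ∷ x ∷ u ∷ [])

  -- The polynomial core of the induction step of `moment-bound`: the hypothesis at n enters through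
  -- u, and the goal carries the weight at n + 1.
  weight-step : ∀ n p x u → let i = suc p; X = 2 * weight n i * x; V = i * n * x + u in
    i * massForm n i X V ≤ 2 * weight (1 + n) i * momentForm n i X V
  weight-step n p x u = dominated
    (iᵉ :* E.massForm nᵉ iᵉ Xᵉ Vᵉ) (con 2 :* E.weight (con 1 :+ nᵉ) iᵉ :* E.momentForm nᵉ iᵉ Xᵉ Vᵉ) _
    (n ∷ p ∷ x ∷ u ∷ [])

  homogeneous : ∀ c a b x v → a * (c * x) + b * (c * v) ≡ c * (a * x + b * v)
  homogeneous = solve-∀

  massForm-homogeneous : ∀ c n i x v → massForm n i (c * x) (c * v) ≡ c * massForm n i x v
  massForm-homogeneous c n i = homogeneous c ((1 + (n + i)) * (4 * (n + i) + 3) + i) (2 * i)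

  momentForm-homogeneous : ∀ c n i x v → momentForm n i (c * x) (c * v) ≡ c * momentForm n i x v
  momentForm-homogeneous c n i = homogeneous c (2 * i + 1) (4 * (n + i) + 4 * i + 5)

  *-swap : ∀ a b c → a * (b * c) ≡ b * (a * c)
  *-swap = solve-∀

  module _ (p : ℕ) (x v : ℕ → ℕ)
    (x-rec : ∀ n → (1 + n) * (1 + (n + suc p)) * x (1 + n) ≡ 2 * massForm n (suc p) (x n) (v n))
    (v-rec : ∀ n → (1 + (n + suc p)) * v (1 + n) ≡ 2 * momentForm n (suc p) (x n) (v n))
    where

    private
      i = suc p

    -- Induction on n; the left side vanishes at 0. In the step the factor `suc n` of the bound
    -- supplies the n + 1 of `x-rec`, and the factor M common to both recurrences cancels. The bound
    -- makes the truncated difference u exact, here and in `ratio-log-convex`.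
    moment-bound : ∀ n → i * n * x n ≤ 2 * weight n i * v n
    moment-bound zero    = ≤-trans (≤-reflexive (cong (_* x 0) (*-zeroʳ i))) z≤n
    moment-bound (suc n) = *-cancelˡ-≤ M (begin
      M * (i * suc n * x (suc n))              ≡⟨ rearrange₁ M i (suc n) _ ⟩
      i * (suc n * M * x (suc n))              ≡⟨ cong (i *_) (x-rec n) ⟩
      i * (2 * massForm n i (x n) (v n))       ≡⟨ *-swap i 2 (massForm n i (x n) (v n)) ⟩
      2 * (i * massForm n i (x n) (v n))       ≤⟨ *-monoʳ-≤ 2 (*-cancelˡ-≤ c scaled) ⟩
      2 * (2 * w * momentForm n i (x n) (v n)) ≡⟨ *-swap 2 (2 * w) (momentForm n i (x n) (v n)) ⟩
      2 * w * (2 * momentForm n i (x n) (v n)) ≡⟨ cong (2 * w *_) (v-rec n) ⟨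
      2 * w * (M * v (suc n))                  ≡⟨ *-swap (2 * w) M (v (suc n)) ⟩
      M * (2 * w * v (suc n))                  ∎)
      where
      open ≤-Reasoning
      M = 1 + (n + i)
      c = 2 * weight n i
      w = weight (1 + n) i
      u = c * v n ∸ i * n * x n
      rearrange₁ : ∀ M i n x → M * (i * n * x) ≡ i * (n * M * x)
      rearrange₁ = solve-∀
      V≡ : i * n * x n + u ≡ c * v n
      V≡ = m+[n∸m]≡n (moment-bound n)
      scaled : c * (i * massForm n i (x n) (v n)) ≤ c * (2 * w * momentForm n i (x n) (v n))
      scaled = subst₂ _≤_
        (trans (cong (i *_) (massForm-homogeneous c n i (x n) (v n))) (*-swap i c (massForm n i (x n) (v n))))
        (trans (cong (2 * w *_) (momentForm-homogeneous c n i (x n) (v n))) (*-swap (2 * w) c (momentForm n i (x n) (v n))))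
        (subst (λ V → i * massForm n i (c * x n) V ≤ 2 * w * momentForm n i (c * x n) V) V≡
          (weight-step n p (x n) u))

    -- By homogeneity, a pair proportional to the values at n is carried to one proportional to the
    -- values at n + 1; K and c record the proportion without division.
    step-mass : ∀ n {K c X V} → K * X ≡ c * x n → K * V ≡ c * v n →
                2 * K * massForm n i X V ≡ c * ((1 + n) * (1 + (n + i))) * x (1 + n)
    step-mass n {K} {c} {X} {V} KX KV = begin
      2 * K * massForm n i X V                  ≡⟨ *-assoc 2 K (massForm n i X V) ⟩
      2 * (K * massForm n i X V)                ≡⟨ cong (2 *_) (massForm-homogeneous K n i X V) ⟨
      2 * massForm n i (K * X) (K * V)          ≡⟨ cong₂ (λ a b → 2 * massForm n i a b) KX KV ⟩
      2 * massForm n i (c * x n) (c * v n)      ≡⟨ cong (2 *_) (massForm-homogeneous c n i (x n) (v n)) ⟩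
      2 * (c * massForm n i (x n) (v n))        ≡⟨ *-swap 2 c (massForm n i (x n) (v n)) ⟩
      c * (2 * massForm n i (x n) (v n))        ≡⟨ cong (c *_) (x-rec n) ⟨
      c * ((1 + n) * (1 + (n + i)) * x (1 + n)) ≡⟨ *-assoc c _ _ ⟨
      c * ((1 + n) * (1 + (n + i))) * x (1 + n) ∎
      where
      open ≡-Reasoning

    -- The extra factor 1 + n, absent from `v-rec`, gives the moment the same denominator as the
    -- mass, so that the two steps can be iterated together.
    step-moment : ∀ n {K c X V} → K * X ≡ c * x n → K * V ≡ c * v n →
                  2 * K * ((1 + n) * momentForm n i X V) ≡ c * ((1 + n) * (1 + (n + i))) * v (1 + n)
    step-moment n {K} {c} {X} {V} KX KV = begin
      2 * K * ((1 + n) * momentForm n i X V)           ≡⟨ rearrange (1 + n) K (momentForm n i X V) ⟩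
      2 * (1 + n) * (K * momentForm n i X V)           ≡⟨ cong (2 * (1 + n) *_) (momentForm-homogeneous K n i X V) ⟨
      2 * (1 + n) * momentForm n i (K * X) (K * V)     ≡⟨ cong₂ (λ a b → 2 * (1 + n) * momentForm n i a b) KX KV ⟩
      2 * (1 + n) * momentForm n i (c * x n) (c * v n) ≡⟨ cong (2 * (1 + n) *_) (momentForm-homogeneous c n i (x n) (v n)) ⟩
      2 * (1 + n) * (c * momentForm n i (x n) (v n))   ≡⟨ rearrange′ (1 + n) c (momentForm n i (x n) (v n)) ⟩
      c * (1 + n) * (2 * momentForm n i (x n) (v n))   ≡⟨ cong (c * (1 + n) *_) (v-rec n) ⟨
      c * (1 + n) * ((1 + (n + i)) * v (1 + n))        ≡⟨ rearrange″ c (1 + n) (1 + (n + i)) _ ⟩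
      c * ((1 + n) * (1 + (n + i))) * v (1 + n)        ∎
      where
      open ≡-Reasoning
      rearrange : ∀ n K z → 2 * K * (n * z) ≡ 2 * n * (K * z)
      rearrange = solve-∀
      rearrange′ : ∀ n c z → 2 * n * (c * z) ≡ c * n * (2 * z)
      rearrange′ = solve-∀
      rearrange″ : ∀ c n M z → c * n * (M * z) ≡ c * (n * M) * z
      rearrange″ = solve-∀

    -- Positivity of the third difference of log x, that is, strict log-convexity of the ratios x (1
    -- + n) / x n with denominators cleared.
    ratio-log-convex : ∀ n → 0 < x n →
      x n * (x (2 + n) * (x (2 + n) * x (2 + n))) < x (3 + n) * (x (1 + n) * (x (1 + n) * x (1 + n)))
    ratio-log-convex n 0<x = *-cancelˡ-< factor _ _ (subst₂ _<_
        (trans (eqˡ (c * x n) y₂ a₁ a₃) (trans (cong (λ Y → c * x n * (Y * (Y * Y)) * (a₁ * a₃)) e₂)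
          (finalˡ c a₁ a₂ a₃ (x n) (x (2 + n)))))
        (trans (eqʳ y₃ y₁ a₂) (trans (cong₂ (λ X Y → X * (Y * (Y * Y)) * (a₂ * a₂)) e₃ e₁)
          (finalʳ c a₁ a₂ a₃ (x (1 + n)) (x (3 + n)))))
        -- 64 = 4³ = 8 · 2³: it supplies the 4 for each of the three `y₂` on the left, and on the
        -- right the 8 for `y₃` and the 2 for each of the three `y₁`.
        (*-monoʳ-< 64 strict))
      where
      c = 2 * weight n i
      u = c * v n ∸ i * n * x n
      open Iterates n i (c * x n) (i * n * x n + u)
      -- The factors a₁ a₃ in `lhs` and a₂² in `rhs` are chosen so that both sides leave this same
      -- constant.
      factor = c * (c * (c * c)) * (a₁ * (a₁ * (a₁ * a₁))) * (a₂ * (a₂ * a₂)) * a₃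
      strict : lhs < rhs
      strict = <-≤-trans (m<m+n lhs (*-mono-< (*-mono-< 0<x 0<x) (*-mono-< 0<x 0<x)))
        (lhs<rhs n p (x n) u)
      v₀ : 1 * (i * n * x n + u) ≡ c * v n
      v₀ = trans (*-identityˡ _) (m+[n∸m]≡n (moment-bound n))
      e₁ : 2 * y₁ ≡ c * a₁ * x (1 + n)
      e₁ = step-mass n {1} {c} {c * x n} {i * n * x n + u} (*-identityˡ _) v₀
      f₁ : 2 * z₁ ≡ c * a₁ * v (1 + n)
      f₁ = step-moment n {1} {c} {c * x n} {i * n * x n + u} (*-identityˡ _) v₀
      e₂ : 4 * y₂ ≡ c * a₁ * a₂ * x (2 + n)
      e₂ = step-mass (1 + n) {2} {c * a₁} {y₁} {z₁} e₁ f₁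
      f₂ : 4 * z₂ ≡ c * a₁ * a₂ * v (2 + n)
      f₂ = step-moment (1 + n) {2} {c * a₁} {y₁} {z₁} e₁ f₁
      e₃ : 8 * y₃ ≡ c * a₁ * a₂ * a₃ * x (3 + n)
      e₃ = step-mass (2 + n) {4} {c * a₁ * a₂} {y₂} {z₂} e₂ f₂
      eqˡ : ∀ x y a b → 64 * (x * (y * (y * y)) * (a * b)) ≡ x * (4 * y * (4 * y * (4 * y))) * (a * b)
      eqˡ = solve-∀
      eqʳ : ∀ x y a → 64 * (x * (y * (y * y)) * (a * a)) ≡ 8 * x * (2 * y * (2 * y * (2 * y))) * (a * a)
      eqʳ = solve-∀
      finalˡ : ∀ c a₁ a₂ a₃ x z →
        c * x * (c * a₁ * a₂ * z * (c * a₁ * a₂ * z * (c * a₁ * a₂ * z))) * (a₁ * a₃) ≡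
        c * (c * (c * c)) * (a₁ * (a₁ * (a₁ * a₁))) * (a₂ * (a₂ * a₂)) * a₃ * (x * (z * (z * z)))
      finalˡ = solve-∀
      finalʳ : ∀ c a₁ a₂ a₃ y z →
        c * a₁ * a₂ * a₃ * z * (c * a₁ * y * (c * a₁ * y * (c * a₁ * y))) * (a₂ * a₂) ≡
        c * (c * (c * c)) * (a₁ * (a₁ * (a₁ * a₁))) * (a₂ * (a₂ * a₂)) * a₃ * (z * (y * (y * y)))
      finalʳ = solve-∀

  -- Binomial coefficients

  -- Indexed by the lower argument and its complement, so that the recurrences below need neither
  -- subtraction nor side conditions.
  binom : ℕ → ℕ → ℕ
  binom k r = (k + r) C k

  binom-! : ∀ k r → binom k r * (k ! * r !) ≡ (k + r) !
  binom-! k r = subst (λ s → binom k r * (k ! * s !) ≡ (k + r) !) (m+n∸m≡n k r)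
    (trans (cong (_* (k ! * (k + r ∸ k) !)) (nCk≡n!/k![n-k]! (m≤m+n k r)))
           (m/n*n≡m {{k !* (k + r ∸ k) !≢0}} (k![n∸k]!∣n! (m≤m+n k r))))

  binom-sucʳ : ∀ k r → suc r * binom k (suc r) ≡ suc (k + r) * binom k r
  binom-sucʳ k r = *-cancelʳ-≡ _ _ (k ! * r !) {{k !* r !≢0}} (begin
    suc r * binom k (suc r) * (k ! * r !)   ≡⟨ rearrange (suc r) (binom k (suc r)) (k !) (r !) ⟩
    binom k (suc r) * (k ! * suc r !)       ≡⟨ binom-! k (suc r) ⟩
    (k + suc r) !                           ≡⟨ cong _! (+-suc k r) ⟩
    suc (k + r) * (k + r) !                 ≡⟨ cong (suc (k + r) *_) (binom-! k r) ⟨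
    suc (k + r) * (binom k r * (k ! * r !)) ≡⟨ *-assoc (suc (k + r)) (binom k r) _ ⟨
    suc (k + r) * binom k r * (k ! * r !)   ∎)
    where
    open ≡-Reasoning
    rearrange : ∀ s b k r → s * b * (k * r) ≡ b * (k * (s * r))
    rearrange = solve-∀

  binom-sucˡ : ∀ k r → suc k * binom (suc k) r ≡ suc (k + r) * binom k r
  binom-sucˡ k r = *-cancelʳ-≡ _ _ (k ! * r !) {{k !* r !≢0}} (begin
    suc k * binom (suc k) r * (k ! * r !)   ≡⟨ rearrange (suc k) (binom (suc k) r) (k !) (r !) ⟩
    binom (suc k) r * (suc k ! * r !)       ≡⟨ binom-! (suc k) r ⟩
    suc (k + r) * (k + r) !                 ≡⟨ cong (suc (k + r) *_) (binom-! k r) ⟨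
    suc (k + r) * (binom k r * (k ! * r !)) ≡⟨ *-assoc (suc (k + r)) (binom k r) _ ⟨
    suc (k + r) * binom k r * (k ! * r !)   ∎)
    where
    open ≡-Reasoning
    rearrange : ∀ s b k r → s * b * (k * r) ≡ b * (s * k * r)
    rearrange = solve-∀

  central-suc : ∀ j → suc j * binom (suc j) (suc j) ≡ 2 * (2 * j + 1) * binom j j
  central-suc j = *-cancelˡ-≡ _ _ (suc j) (begin
    suc j * (suc j * binom (suc j) (suc j))     ≡⟨ cong (suc j *_) (binom-sucˡ j (suc j)) ⟩
    suc j * (suc (j + suc j) * binom j (suc j)) ≡⟨ rearrange j (binom j (suc j)) ⟩
    2 * suc j * (suc j * binom j (suc j))       ≡⟨ cong (2 * suc j *_) (binom-sucʳ j j) ⟩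
    2 * suc j * (suc (j + j) * binom j j)       ≡⟨ rearrange′ j (binom j j) ⟩
    suc j * (2 * (2 * j + 1) * binom j j)       ∎)
    where
    open ≡-Reasoning
    rearrange : ∀ j b → suc j * (suc (j + suc j) * b) ≡ 2 * suc j * (suc j * b)
    rearrange = solve-∀
    rearrange′ : ∀ j b → 2 * suc j * (suc (j + j) * b) ≡ suc j * (2 * (2 * j + 1) * b)
    rearrange′ = solve-∀

  -- Sums over antidiagonals

  antidiagonal : (ℕ → ℕ → ℕ) → ℕ → ℕ
  antidiagonal f zero    = f 0 0
  antidiagonal f (suc n) = f 0 (suc n) + antidiagonal (f ∘ suc) n

  antidiagonal-cong : ∀ {f g : ℕ → ℕ → ℕ} n → (∀ l j → l + j ≡ n → f l j ≡ g l j) →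
                      antidiagonal f n ≡ antidiagonal g n
  antidiagonal-cong zero    eq = eq 0 0 refl
  antidiagonal-cong (suc n) eq = cong₂ _+_ (eq 0 (suc n) refl)
    (antidiagonal-cong n (λ l j l+j≡n → eq (suc l) j (cong suc l+j≡n)))

  antidiagonal-+ : ∀ (f g : ℕ → ℕ → ℕ) n →
    antidiagonal (λ l j → f l j + g l j) n ≡ antidiagonal f n + antidiagonal g n
  antidiagonal-+ f g zero    = refl
  antidiagonal-+ f g (suc n) rewrite antidiagonal-+ (f ∘ suc) (g ∘ suc) n =
    interchange (f 0 (suc n)) (g 0 (suc n)) _ _
    where
    interchange : ∀ a b c d → a + b + (c + d) ≡ a + c + (b + d)
    interchange = solve-∀

  antidiagonal-* : ∀ c (f : ℕ → ℕ → ℕ) n → antidiagonal (λ l j → c * f l j) n ≡ c * antidiagonal f n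
  antidiagonal-* c f zero    = refl
  antidiagonal-* c f (suc n) rewrite antidiagonal-* c (f ∘ suc) n =
    sym (*-distribˡ-+ c (f 0 (suc n)) _)

  antidiagonal-scale : ∀ (c : ℕ → ℕ) (f : ℕ → ℕ → ℕ) n →
    antidiagonal (λ l j → c (l + j) * f l j) n ≡ c n * antidiagonal f n
  antidiagonal-scale c f n = trans
    (antidiagonal-cong n (λ l j l+j≡n → cong (λ s → c s * f l j) l+j≡n)) (antidiagonal-* (c n) f n)

  -- Creative telescoping without subtraction: `P` is the certificate at one point of an
  -- antidiagonal and `H` its value at the next point. Summing `step` over l + j = n cancels all of
  -- these except P 0 n and H n 0; the latter is, by `end`, the last entry of the sum of `A`, which
  -- `step` does not reach.
  telescope : ∀ n (A B H P : ℕ → ℕ → ℕ) →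
    (∀ l j → A l (suc j) + H l j ≡ B l j + P l j) →
    (∀ l j → P (suc l) j ≡ H l (suc j)) →
    (∀ l → A (suc l) 0 ≡ H l 0) →
    antidiagonal A (suc n) ≡ antidiagonal B n + P 0 n
  telescope zero A B H P step shift end = trans (cong (A 0 1 +_) (end 0)) (step 0 0)
  telescope (suc n) A B H P step shift end = begin
    A 0 (2 + n) + antidiagonal (A ∘ suc) (suc n)
      ≡⟨ cong (A 0 (2 + n) +_) (telescope n (A ∘ suc) (B ∘ suc) (H ∘ suc) (P ∘ suc)
           (step ∘ suc) (shift ∘ suc) (end ∘ suc)) ⟩
    A 0 (2 + n) + (ΣB + P 1 n)
      ≡⟨ cong (λ t → A 0 (2 + n) + (ΣB + t)) (shift 0 n) ⟩
    A 0 (2 + n) + (ΣB + H 0 (suc n))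
      ≡⟨ rearrange (A 0 (2 + n)) ΣB (H 0 (suc n)) ⟩
    A 0 (2 + n) + H 0 (suc n) + ΣB
      ≡⟨ cong (_+ ΣB) (step 0 (suc n)) ⟩
    B 0 (suc n) + P 0 (suc n) + ΣB
      ≡⟨ rearrange′ (B 0 (suc n)) (P 0 (suc n)) ΣB ⟩
    B 0 (suc n) + ΣB + P 0 (suc n) ∎
    where
    open ≡-Reasoning
    ΣB = antidiagonal (B ∘ suc) n
    rearrange : ∀ a b c → a + (b + c) ≡ a + c + b
    rearrange = solve-∀
    rearrange′ : ∀ a b c → a + b + c ≡ a + c + b
    rearrange′ = solve-∀

  sum-applyUpTo : ∀ n (f : ℕ → ℕ) (g : ℕ → ℕ → ℕ) → (∀ l j → l + j ≡ n → f l ≡ g l j) →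
                  sum (applyUpTo f (suc n)) ≡ antidiagonal g n
  sum-applyUpTo zero    f g eq = trans (+-identityʳ (f 0)) (eq 0 0 refl)
  sum-applyUpTo (suc n) f g eq = cong₂ _+_ (eq 0 (suc n) refl)
    (sum-applyUpTo n (f ∘ suc) (g ∘ suc) (λ l j l+j≡n → eq (suc l) j (cong suc l+j≡n)))

  -- The Boros–Moll sums

  module _ (i : ℕ) where

    -- The summand of dᵢ(i + l + j) with k = i + l.
    term : ℕ → ℕ → ℕ
    term l j = 2 ^ (i + l) * binom j j * binom (i + l) (i + l + j) * binom i l

    -- The sequences x and v: with m = i + n and k = i + l, the index j on the antidiagonal is m -
    -- k.
    mass moment : ℕ → ℕ
    mass = antidiagonal term
    moment = antidiagonal (λ l j → j * term l j)

    dTerm≡term : ∀ l j → dTerm i (i + (l + j)) (i + l) ≡ term l j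
    dTerm≡term l j = cong₂ (λ a b → 2 ^ (i + l) * a * b * binom i l)
      (cong₂ _C_ 2m∸2k≡j+j m∸k≡j)
      (cong (_C (i + l)) (m+k≡k+m i l j))
      where
      m≡k+j : i + (l + j) ≡ i + l + j
      m≡k+j = sym (+-assoc i l j)
      m∸k≡j : i + (l + j) ∸ (i + l) ≡ j
      m∸k≡j = trans (cong (_∸ (i + l)) m≡k+j) (m+n∸m≡n (i + l) j)
      2m∸2k≡j+j : 2 * (i + (l + j)) ∸ 2 * (i + l) ≡ j + j
      2m∸2k≡j+j = trans (sym (*-distribˡ-∸ 2 (i + (l + j)) (i + l)))
        (trans (cong (2 *_) m∸k≡j) (cong (j +_) (+-identityʳ j)))
      m+k≡k+m : ∀ i l j → i + (l + j) + (i + l) ≡ i + l + (i + l + j)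
      m+k≡k+m = solve-∀

    dSum≡mass : ∀ n → dSum i (i + n) ≡ mass n
    dSum≡mass n = begin
      sum (map f (upTo (suc (i + n) ∸ i))) ≡⟨ cong (λ s → sum (map f (upTo s))) length≡ ⟩
      sum (map f (upTo (suc n)))           ≡⟨ cong sum (map-applyUpTo id f (suc n)) ⟩
      sum (applyUpTo f (suc n))            ≡⟨ sum-applyUpTo n f term (λ { l j refl → dTerm≡term l j }) ⟩
      antidiagonal term n                  ∎
      where
      open ≡-Reasoning
      f : ℕ → ℕ
      f l = dTerm i (i + n) (i + l)
      length≡ : suc (i + n) ∸ i ≡ suc n
      length≡ = trans (cong (_∸ i) (sym (+-suc i n))) (m+n∸m≡n i (suc n))

    -- Hypergeometric ratio for m to m + 1 at fixed k: only the central binomial and the middle one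
    -- change.
    term-sucʳ : ∀ l j → suc j * suc (l + j + i) * term l (suc j) ≡
                        2 * (2 * j + 1) * suc (2 * (i + l) + j) * term l j
    term-sucʳ l j = begin
      suc j * suc (l + j + i) * (t * c′ * binom k (k + suc j) * b)
        ≡⟨ cong (λ s → suc j * suc (l + j + i) * (t * c′ * binom k s * b)) (+-suc k j) ⟩
      suc j * suc (l + j + i) * (t * c′ * binom k (suc (k + j)) * b)
        ≡⟨ rearrange i l j t c′ (binom k (suc (k + j))) b ⟩
      t * (suc j * c′) * (suc (k + j) * binom k (suc (k + j))) * b
        ≡⟨ cong₂ (λ p q → t * p * q * b) (central-suc j) (binom-sucʳ k (k + j)) ⟩
      t * (2 * (2 * j + 1) * c) * (suc (k + (k + j)) * binom k (k + j)) * b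
        ≡⟨ rearrange′ i l j t c (binom k (k + j)) b ⟩
      2 * (2 * j + 1) * suc (2 * (i + l) + j) * (t * c * binom k (k + j) * b) ∎
      where
      open ≡-Reasoning
      k = i + l
      t = 2 ^ k
      c = binom j j
      c′ = binom (suc j) (suc j)
      b = binom i l
      rearrange : ∀ i l j t c d b →
        suc j * suc (l + j + i) * (t * c * d * b) ≡ t * (suc j * c) * (suc (i + l + j) * d) * b
      rearrange = solve-∀
      rearrange′ : ∀ i l j t c d b →
        t * (2 * (2 * j + 1) * c) * (suc (i + l + (i + l + j)) * d) * b ≡
        2 * (2 * j + 1) * suc (2 * (i + l) + j) * (t * c * d * b)
      rearrange′ = solve-∀

    -- Hypergeometric ratio for k to k + 1 at fixed m, a move along the antidiagonal. The factor k +
    -- 1 produced by `binom i (suc l)` is absorbed when the middle binomial is lowered.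
    term-sucˡ : ∀ l j → (2 * j + 1) * suc l * term (suc l) j ≡
                        suc j * (2 + 2 * (i + l) + j) * term l (suc j)
    term-sucˡ l j = begin
      (2 * j + 1) * suc l * (2 ^ (i + suc l) * c * binom (i + suc l) (i + suc l + j) * b′)
        ≡⟨ cong (λ s → (2 * j + 1) * suc l * (2 ^ s * c * binom s (s + j) * b′)) (+-suc i l) ⟩
      (2 * j + 1) * suc l * (2 * t * c * binom (suc k) (suc k + j) * b′)
        ≡⟨ rearrange j (suc l) t c (binom (suc k) (suc k + j)) b′ ⟩
      t * (2 * (2 * j + 1) * c) * binom (suc k) (suc k + j) * (suc l * b′)
        ≡⟨ cong₂ (λ p q → t * p * binom (suc k) (suc k + j) * q) (sym (central-suc j)) (binom-sucʳ i l) ⟩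
      t * (suc j * c′) * binom (suc k) (suc k + j) * (suc k * b)
        ≡⟨ rearrange′ t (suc j * c′) (binom (suc k) (suc k + j)) (suc k) b ⟩
      t * (suc j * c′) * (suc k * binom (suc k) (suc k + j)) * b
        ≡⟨ cong (λ p → t * (suc j * c′) * p * b) (binom-sucˡ k (suc k + j)) ⟩
      t * (suc j * c′) * (suc (k + suc (k + j)) * binom k (suc (k + j))) * b
        ≡⟨ cong (λ s → t * (suc j * c′) * (suc (k + suc (k + j)) * binom k s) * b) (sym (+-suc k j)) ⟩
      t * (suc j * c′) * (suc (k + suc (k + j)) * binom k (k + suc j)) * b
        ≡⟨ rearrange″ i l j t c′ (binom k (k + suc j)) b ⟩
      suc j * (2 + 2 * (i + l) + j) * (t * c′ * binom k (k + suc j) * b) ∎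
      where
      open ≡-Reasoning
      k = i + l
      t = 2 ^ k
      c = binom j j
      c′ = binom (suc j) (suc j)
      b = binom i l
      b′ = binom i (suc l)
      rearrange : ∀ j l t c d b →
        (2 * j + 1) * l * (2 * t * c * d * b) ≡ t * (2 * (2 * j + 1) * c) * d * (l * b)
      rearrange = solve-∀
      rearrange′ : ∀ t c d s b → t * c * d * (s * b) ≡ t * c * (s * d) * b
      rearrange′ = solve-∀
      rearrange″ : ∀ i l j t c d b →
        t * (suc j * c) * (suc (i + l + suc (i + l + j)) * d) * b ≡
        suc j * (2 + 2 * (i + l) + j) * (t * c * d * b)
      rearrange″ = solve-∀

    -- The Wilf–Zeilberger certificate of both recurrences is a multiple of this shifted summand.
    private
      previous : ℕ → ℕ → ℕ
      previous zero    j = 0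
      previous (suc l) j = (2 + 2 * (i + l) + j) * term l (suc j)

      -- Identifies `previous l j` as (2 j + 1) l / (j + 1) times `term l j`; its definition through
      -- the neighbouring summand keeps it in ℕ.
      previous-term : ∀ l j → (2 * j + 1) * l * term l j ≡ suc j * previous l j
      previous-term zero    j = trans (cong (_* term 0 j) (*-zeroʳ (2 * j + 1))) (sym (*-zeroʳ (suc j)))
      previous-term (suc l) j = trans (term-sucˡ l j) (*-assoc (suc j) (2 + 2 * (i + l) + j) (term l (suc j)))

    mass-recurrence : ∀ n → (1 + n) * (1 + (n + i)) * mass (1 + n) ≡ 2 * massForm n i (mass n) (moment n)
    mass-recurrence n = begin
      a (suc n) * mass (suc n) ≡⟨ antidiagonal-scale a term (suc n) ⟨
      antidiagonal A (suc n)   ≡⟨ telescope n A B H P step shift end ⟩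
      -- The certificate vanishes at l = 0 because `previous 0` does.
      antidiagonal B n + P 0 n ≡⟨ trans (cong (antidiagonal B n +_) (*-zeroʳ (4 * suc (n + i)))) (+-identityʳ _) ⟩
      antidiagonal B n         ≡⟨ antidiagonal-+ (λ l j → b (l + j) * term l j) (λ l j → 4 * i * (j * term l j)) n ⟩
      antidiagonal (λ l j → b (l + j) * term l j) n + antidiagonal (λ l j → 4 * i * (j * term l j)) n
        ≡⟨ cong₂ _+_ (antidiagonal-scale b term n) (antidiagonal-* (4 * i) (λ l j → j * term l j) n) ⟩
      b n * mass n + 4 * i * moment n      ≡⟨ rearrange ((1 + (n + i)) * (4 * (n + i) + 3) + i) i (mass n) (moment n) ⟩
      2 * massForm n i (mass n) (moment n) ∎
      where
      open ≡-Reasoning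
      a b : ℕ → ℕ
      a s = s * (s + i)
      b s = 2 * ((1 + (s + i)) * (4 * (s + i) + 3) + i)
      A B H P : ℕ → ℕ → ℕ
      A l j = a (l + j) * term l j
      B l j = b (l + j) * term l j + 4 * i * (j * term l j)
      H l j = 4 * suc (l + j + i) * (suc (2 * (i + l) + j) * term l j)
      P l j = 4 * suc (l + j + i) * previous l j
      rearrange : ∀ c i x v → 2 * c * x + 4 * i * v ≡ 2 * (c * x + 2 * i * v)
      rearrange = solve-∀
      step : ∀ l j → A l (suc j) + H l j ≡ B l j + P l j
      -- Multiplying by j + 1 clears the denominators of both `term-sucʳ` and `previous-term`.
      step l j = *-cancelˡ-≡ _ _ (suc j) (begin
        suc j * (A l (suc j) + H l j)
          ≡⟨ r₁ i l j (term l (suc j)) (term l j) ⟩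
        suc (l + j) * (suc j * suc (l + j + i) * term l (suc j)) + suc j * H l j
          ≡⟨ cong (λ t → suc (l + j) * t + suc j * H l j) (term-sucʳ l j) ⟩
        suc (l + j) * (2 * (2 * j + 1) * suc (2 * (i + l) + j) * term l j) + suc j * H l j
          ≡⟨ r₂ i l j (term l j) ⟩
        suc j * B l j + 4 * suc (l + j + i) * ((2 * j + 1) * l * term l j)
          ≡⟨ cong (λ t → suc j * B l j + 4 * suc (l + j + i) * t) (previous-term l j) ⟩
        suc j * B l j + 4 * suc (l + j + i) * (suc j * previous l j)
          ≡⟨ r₃ (suc j) (B l j) (4 * suc (l + j + i)) (previous l j) ⟩
        suc j * (B l j + P l j) ∎)
        where
        r₁ : ∀ i l j t′ t → suc j * ((l + suc j) * (l + suc j + i) * t′ + 4 * suc (l + j + i) * (suc (2 * (i + l) + j) * t)) ≡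
          suc (l + j) * (suc j * suc (l + j + i) * t′) + suc j * (4 * suc (l + j + i) * (suc (2 * (i + l) + j) * t))
        r₁ = solve-∀
        r₂ : ∀ i l j t →
          suc (l + j) * (2 * (2 * j + 1) * suc (2 * (i + l) + j) * t) +
            suc j * (4 * suc (l + j + i) * (suc (2 * (i + l) + j) * t)) ≡
          suc j * (2 * ((1 + (l + j + i)) * (4 * (l + j + i) + 3) + i) * t + 4 * i * (j * t)) +
            4 * suc (l + j + i) * ((2 * j + 1) * l * t)
        r₂ = solve-∀
        r₃ : ∀ s b c p → s * b + c * (s * p) ≡ s * (b + c * p)
        r₃ = solve-∀
      shift : ∀ l j → P (suc l) j ≡ H l (suc j)
      shift l j = r i l j (term l (suc j))
        where
        r : ∀ i l j t → 4 * suc (suc l + j + i) * ((2 + 2 * (i + l) + j) * t) ≡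
                        4 * suc (l + suc j + i) * (suc (2 * (i + l) + suc j) * t)
        r = solve-∀
      end : ∀ l → A (suc l) 0 ≡ H l 0
      -- The new summand k = m + 1 is reached from k = m in two moves, through `term l 1`.
      end l = begin
        A (suc l) 0                                                            ≡⟨ r₁ i l (term (suc l) 0) ⟩
        suc (l + i) * ((2 * 0 + 1) * suc l * term (suc l) 0)                   ≡⟨ cong (suc (l + i) *_) (term-sucˡ l 0) ⟩
        suc (l + i) * (1 * (2 + 2 * (i + l) + 0) * term l 1)                   ≡⟨ r₂ i l (term l 1) ⟩
        2 * suc (l + i) * (1 * suc (l + 0 + i) * term l 1)                     ≡⟨ cong (2 * suc (l + i) *_) (term-sucʳ l 0) ⟩
        2 * suc (l + i) * (2 * (2 * 0 + 1) * suc (2 * (i + l) + 0) * term l 0) ≡⟨ r₃ i l (term l 0) ⟩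
        H l 0                                                                  ∎
        where
        r₁ : ∀ i l t → (suc l + 0) * (suc l + 0 + i) * t ≡ suc (l + i) * ((2 * 0 + 1) * suc l * t)
        r₁ = solve-∀
        r₂ : ∀ i l t → suc (l + i) * (1 * (2 + 2 * (i + l) + 0) * t) ≡ 2 * suc (l + i) * (1 * suc (l + 0 + i) * t)
        r₂ = solve-∀
        r₃ : ∀ i l t → 2 * suc (l + i) * (2 * (2 * 0 + 1) * suc (2 * (i + l) + 0) * t) ≡
                       4 * suc (l + 0 + i) * (suc (2 * (i + l) + 0) * t)
        r₃ = solve-∀

    moment-recurrence : ∀ n → (1 + (n + i)) * moment (1 + n) ≡ 2 * momentForm n i (mass n) (moment n)
    moment-recurrence n = begin
      a (suc n) * moment (suc n) ≡⟨ antidiagonal-scale a (λ l j → j * term l j) (suc n) ⟨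
      antidiagonal A (suc n)     ≡⟨ telescope n A B H P step shift end ⟩
      antidiagonal B n + P 0 n   ≡⟨ trans (cong (antidiagonal B n +_) (*-zeroʳ (4 * suc n))) (+-identityʳ _) ⟩
      antidiagonal B n           ≡⟨ antidiagonal-+ (λ l j → 2 * (2 * i + 1) * term l j) (λ l j → b (l + j) * (j * term l j)) n ⟩
      antidiagonal (λ l j → 2 * (2 * i + 1) * term l j) n + antidiagonal (λ l j → b (l + j) * (j * term l j)) n
        ≡⟨ cong₂ _+_ (antidiagonal-* (2 * (2 * i + 1)) term n) (antidiagonal-scale b (λ l j → j * term l j) n) ⟩
      2 * (2 * i + 1) * mass n + b n * moment n ≡⟨ rearrange (2 * i + 1) (4 * (n + i) + 4 * i + 5) (mass n) (moment n) ⟩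
      2 * momentForm n i (mass n) (moment n)    ∎
      where
      open ≡-Reasoning
      a b : ℕ → ℕ
      a s = s + i
      b s = 2 * (4 * (s + i) + 4 * i + 5)
      A B H P : ℕ → ℕ → ℕ
      A l j = a (l + j) * (j * term l j)
      B l j = 2 * (2 * i + 1) * term l j + b (l + j) * (j * term l j)
      H l j = 4 * j * (suc (2 * (i + l) + j) * term l j)
      P l j = 4 * suc j * previous l j
      rearrange : ∀ c d x v → 2 * c * x + 2 * d * v ≡ 2 * (c * x + d * v)
      rearrange = solve-∀
      step : ∀ l j → A l (suc j) + H l j ≡ B l j + P l j
      -- The weight of the moment at `suc j` already supplies the factor that `term-sucʳ` requires,
      -- so nothing has to be cancelled.
      step l j = begin
        A l (suc j) + H l j
          ≡⟨ r₁ i l j (term l (suc j)) (H l j) ⟩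
        suc j * suc (l + j + i) * term l (suc j) + H l j
          ≡⟨ cong (_+ H l j) (term-sucʳ l j) ⟩
        2 * (2 * j + 1) * suc (2 * (i + l) + j) * term l j + H l j
          ≡⟨ r₂ i l j (term l j) ⟩
        B l j + 4 * ((2 * j + 1) * l * term l j)
          ≡⟨ cong (λ t → B l j + 4 * t) (previous-term l j) ⟩
        B l j + 4 * (suc j * previous l j)
          ≡⟨ cong (B l j +_) (sym (*-assoc 4 (suc j) (previous l j))) ⟩
        B l j + P l j ∎
        where
        r₁ : ∀ i l j t h → (l + suc j + i) * (suc j * t) + h ≡ suc j * suc (l + j + i) * t + h
        r₁ = solve-∀
        r₂ : ∀ i l j t →
          2 * (2 * j + 1) * suc (2 * (i + l) + j) * t + 4 * j * (suc (2 * (i + l) + j) * t) ≡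
          2 * (2 * i + 1) * t + 2 * (4 * (l + j + i) + 4 * i + 5) * (j * t) + 4 * ((2 * j + 1) * l * t)
        r₂ = solve-∀
      shift : ∀ l j → P (suc l) j ≡ H l (suc j)
      shift l j = cong (λ s → 4 * suc j * (s * term l (suc j))) (sym (cong suc (+-suc (2 * (i + l)) j)))
      end : ∀ l → A (suc l) 0 ≡ H l 0
      end l = *-zeroʳ (a (suc l + 0))

  -- The initial value: d_i(i) ≥ 1

  2^k≤central : ∀ k → 2 ^ k ≤ binom k k
  2^k≤central zero    = ≤-refl
  2^k≤central (suc k) = *-cancelˡ-≤ (suc k) (begin
    suc k * (2 * 2 ^ k)           ≡⟨ rearrange (suc k) (2 ^ k) ⟩
    2 * suc k * 2 ^ k             ≤⟨ *-mono-≤ (*-monoʳ-≤ 2 bound) (2^k≤central k) ⟩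
    2 * (2 * k + 1) * binom k k   ≡⟨ central-suc k ⟨
    suc k * binom (suc k) (suc k) ∎)
    where
    open ≤-Reasoning
    rearrange : ∀ s t → s * (2 * t) ≡ 2 * s * t
    rearrange = solve-∀
    bound : suc k ≤ 2 * k + 1
    bound = subst (suc k ≤_) (+-comm 1 (2 * k)) (s≤s (m≤m+n k (k + 0)))

  -- For m = i the sum has the single summand k = i, and its central binomial coefficient is at
  -- least 2^i.
  4^i≤dSum : ∀ i → 2 ^ (2 * (i + 0)) ≤ dSum i (i + 0)
  4^i≤dSum i = begin
    2 ^ (2 * k)                 ≡⟨ cong (λ e → 2 ^ (k + e)) (+-identityʳ k) ⟩
    2 ^ (k + k)                 ≡⟨ ^-distribˡ-+-* 2 k k ⟩
    2 ^ k * 2 ^ k               ≤⟨ *-monoʳ-≤ (2 ^ k) (2^k≤central k) ⟩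
    2 ^ k * binom k k           ≡⟨ cong (λ r → 2 ^ k * binom k r) (+-identityʳ k) ⟨
    2 ^ k * binom k (k + 0)     ≡⟨ cong (_* binom k (k + 0)) (*-identityʳ (2 ^ k)) ⟨
    2 ^ k * 1 * binom k (k + 0) ≤⟨ m≤m*n _ (binom i 0) {{>-nonZero (0<nCk (i + 0) i (m≤m+n i 0))}} ⟩
    term i 0 0                  ≡⟨ dSum≡mass i 0 ⟨
    dSum i (i + 0)              ∎
    where
    open ≤-Reasoning
    k = i + 0

  dSum-ratio-log-convex : ∀ p n → let D = λ k → dSum (suc p) (suc p + k) in
    D n * (D (2 + n) * (D (2 + n) * D (2 + n))) < D (3 + n) * (D (1 + n) * (D (1 + n) * D (1 + n)))
  dSum-ratio-log-convex p n = subst₂ _<_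
    (cong₂ _*_ (x≡ n) (cong cube (x≡ (2 + n)))) (cong₂ _*_ (x≡ (3 + n)) (cong cube (x≡ (1 + n))))
    (ratio-log-convex p (mass i) (moment i) (mass-recurrence i) (moment-recurrence i) n
      (subst (0 <_) (dSum≡mass i n) (0<dSum (m≤m+n i n))))
    where
    i = suc p
    cube : ℕ → ℕ
    cube m = m * (m * m)
    x≡ : ∀ k → mass i k ≡ dSum i (i + k)
    x≡ k = sym (dSum≡mass i k)

open import Defs
open import Data.Nat.Base using (ℕ; suc; NonZero; _+_)
open import Data.Nat.Properties using (m≤m+n)

-- Rational bounds for roots, and the passage to the reals

module Rationals where

  open import Algebra.Bundles using (CommutativeRing)
  open import Data.Empty using (⊥-elim)
  open import Data.Integer.Base as ℤ using (+_)
  import Data.Integer.Properties as ℤ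
  import Data.Nat.Base as ℕ
  import Data.Nat.Properties as ℕ
  open import Data.Rational.Base hiding (NonZero; _+_)
  open import Data.Rational.Properties
  open import Data.Rational.Unnormalised.Base using (mkℚᵘ; *≡*)
  import Data.Rational.Unnormalised.Properties as ℚᵘ
  open import Relation.Nullary using (yes; no)
  open Naturals using (4^i≤dSum; dSum-ratio-log-convex)

  open import Algebra.Properties.CommutativeSemiring.Exp
    (CommutativeRing.commutativeSemiring +-*-commutativeRing)
    using (^-homo-*; ^-assocʳ; ^-distrib-*)
  open import Algebra.Properties.CommutativeSemigroup
    (CommutativeRing.*-commutativeSemigroup +-*-commutativeRing)
    using (interchange; x∙yz≈y∙xz)

  private
    0<1 : 0ℚ < 1ℚ
    0<1 = positive⁻¹ 1ℚ

  ^-cancel-< : ∀ n {p q} → 0ℚ < q → p ^ n < q ^ n → p < q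
  ^-cancel-< n {p} {q} 0<q p^<q^ with p <? q
  ... | yes p<q = p<q
  ... | no  p≮q = ⊥-elim (<-irrefl refl (<-≤-trans p^<q^ (^-mono-≤ n 0<q (≮⇒≥ p≮q))))

  *-mono-≤-pos : ∀ {p q r s} → 0ℚ < p → 0ℚ < r → p ≤ q → r ≤ s → p * r ≤ q * s
  *-mono-≤-pos 0<p 0<r p≤q r≤s = *-mono-≤-0< 0<r (<-≤-trans 0<p p≤q) p≤q r≤s

  approximate-≤ : ∀ (x : ℝ⁺) {κ} → 1ℚ < κ → ∃[ s ] ∃[ t ] ℝ⁺.L x s × ℝ⁺.U x t × t ≤ κ * s
  approximate-≤ x {κ} 1<κ = tidy (ℝ⁺.approximate x 0<1 1<κ)
    where
    tidy : ∃[ s ] ∃[ t ] ℝ⁺.L x s × ℝ⁺.U x t × 1ℚ * t < κ * s →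
           ∃[ s ] ∃[ t ] ℝ⁺.L x s × ℝ⁺.U x t × t ≤ κ * s
    tidy (s , t , Ls , Ut , lt) = s , t , Ls , Ut , <⇒≤ (subst (_< κ * s) (*-identityˡ t) lt)

  -- Continuity of the n-th power at 1; it supplies the κ whose power stays below the slack Λ.
  1<⇒^-< : ∀ n {r} → 1ℚ < r → ∃[ q ] 1ℚ < q × q ^ n < r
  1<⇒^-< n {r} 1<r = ^-gap-above n 0<1 (subst (_< r) (sym (1^n≡1 n)) 1<r)

  -- Rational approximations s ≤ · ≤ t of the three roots with t ≤ κ s distort t t / (s s) by at
  -- most κ⁴, so a slack Λ > κ^(4N) in the N-th powers, N = n (n+1) (n+2), survives.
  module _ (n : ℕ) {α β γ κ Λ : ℚ} (0<α : 0ℚ < α) (0<γ : 0ℚ < γ) (0<κ : 0ℚ < κ) where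

    private
      A = (1 ℕ.+ n) ℕ.* (2 ℕ.+ n)
      B = 2 ℕ.* (n ℕ.* (2 ℕ.+ n))
      C = n ℕ.* (1 ℕ.+ n)
      N = n ℕ.* A

      spread : ∀ {s s′ t t′} → 0ℚ < t → 0ℚ < t′ → t ≤ κ * s → t′ ≤ κ * s′ →
               (t * t′) ^ N ≤ κ ^ (2 ℕ.* N) * (s * s′) ^ N
      spread {s} {s′} {t} {t′} 0<t 0<t′ t≤ t′≤ = begin
        (t * t′) ^ N                 ≤⟨ ^-mono-≤ N (0<*0< 0<t 0<t′) (*-mono-≤-pos 0<t 0<t′ t≤ t′≤) ⟩
        (κ * s * (κ * s′)) ^ N       ≡⟨ cong (_^ N) (interchange κ s κ s′) ⟩
        (κ * κ * (s * s′)) ^ N       ≡⟨ ^-distrib-* (κ * κ) (s * s′) N ⟩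
        (κ * κ) ^ N * (s * s′) ^ N   ≡⟨ cong (_* (s * s′) ^ N) square^ ⟩
        κ ^ (2 ℕ.* N) * (s * s′) ^ N ∎
        where
        open ≤-Reasoning
        square^ : (κ * κ) ^ N ≡ κ ^ (2 ℕ.* N)
        square^ = trans (^-distrib-* κ κ N) (trans (sym (^-homo-* κ N N))
          (cong (λ e → κ ^ (N ℕ.+ e)) (sym (ℕ.+-identityʳ N))))

    approximants-< : ∀ {sx tx sy ty sz tz} →
      0ℚ < sx → 0ℚ < tx → 0ℚ < sy → 0ℚ < ty → 0ℚ < sz → 0ℚ < tz →
      α < tx ^ n → sy ^ (1 ℕ.+ n) < β → γ < tz ^ (2 ℕ.+ n) →
      tx ≤ κ * sx → ty ≤ κ * sy → tz ≤ κ * sz →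
      κ ^ (2 ℕ.* N ℕ.+ 2 ℕ.* N) < Λ → Λ * β ^ B ≡ α ^ A * γ ^ C → ty * ty < sx * sz
    approximants-< {sx} {tx} {sy} {ty} {sz} {tz} 0<sx 0<tx 0<sy 0<ty 0<sz 0<tz
      α<tx^ sy^<β γ<tz^ tx≤ ty≤ tz≤ κ^<Λ Λβ≡ = ^-cancel-< N 0<sxsz (*-cancelʳ-< (^-pos N 0<txtz) (begin-strict
        -- Passing from upper to lower approximants costs κ^(2N) twice, and κ^(4N) < Λ is the only
        -- strict step. The bounds on β, α, γ then return (tx tz)^N, which cancels; the exponents
        -- fit because 2N = (n+1) B and N = n A = (n+2) C.
        (ty * ty) ^ N * (tx * tz) ^ N
          ≤⟨ *-mono-≤-pos (^-pos N (0<*0< 0<ty 0<ty)) (^-pos N 0<txtz)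
               (spread 0<ty 0<ty ty≤ ty≤) (spread 0<tx 0<tz tx≤ tz≤) ⟩
        κ ^ (2 ℕ.* N) * (sy * sy) ^ N * (κ ^ (2 ℕ.* N) * (sx * sz) ^ N)
          ≡⟨ interchange (κ ^ (2 ℕ.* N)) ((sy * sy) ^ N) (κ ^ (2 ℕ.* N)) ((sx * sz) ^ N) ⟩
        κ ^ (2 ℕ.* N) * κ ^ (2 ℕ.* N) * ((sy * sy) ^ N * (sx * sz) ^ N)
          ≡⟨ cong (_* ((sy * sy) ^ N * (sx * sz) ^ N)) (^-homo-* κ (2 ℕ.* N) (2 ℕ.* N)) ⟨
        κ ^ (2 ℕ.* N ℕ.+ 2 ℕ.* N) * ((sy * sy) ^ N * (sx * sz) ^ N)
          <⟨ *-monoˡ-< (0<*0< 0<sysy^ 0<sxsz^) κ^<Λ ⟩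
        Λ * ((sy * sy) ^ N * (sx * sz) ^ N)
          ≤⟨ *-mono-≤-pos 0<Λ (0<*0< 0<sysy^ 0<sxsz^) ≤-refl (*-mono-≤-pos 0<sysy^ 0<sxsz^ sy≤ ≤-refl) ⟩
        Λ * (β ^ B * (sx * sz) ^ N)
          ≡⟨ *-assoc Λ (β ^ B) ((sx * sz) ^ N) ⟨
        Λ * β ^ B * (sx * sz) ^ N
          ≡⟨ cong (_* (sx * sz) ^ N) Λβ≡ ⟩
        α ^ A * γ ^ C * (sx * sz) ^ N
          ≤⟨ *-mono-≤-pos (0<*0< (^-pos A 0<α) (^-pos C 0<γ)) 0<sxsz^
               (*-mono-≤-pos (^-pos A 0<α) (^-pos C 0<γ) ≤tx ≤tz) ≤-refl ⟩
        tx ^ N * tz ^ N * (sx * sz) ^ N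
          ≡⟨ cong (_* (sx * sz) ^ N) (^-distrib-* tx tz N) ⟨
        (tx * tz) ^ N * (sx * sz) ^ N
          ≡⟨ *-comm ((tx * tz) ^ N) ((sx * sz) ^ N) ⟩
        (sx * sz) ^ N * (tx * tz) ^ N ∎))
      where
      open ≤-Reasoning
      0<sxsz = 0<*0< 0<sx 0<sz
      0<txtz = 0<*0< 0<tx 0<tz
      0<sxsz^ = ^-pos N 0<sxsz
      0<sysy^ = ^-pos N (0<*0< 0<sy 0<sy)

      0<Λ : 0ℚ < Λ
      0<Λ = <-trans (^-pos (2 ℕ.* N ℕ.+ 2 ℕ.* N) 0<κ) κ^<Λ

      sy≤ : (sy * sy) ^ N ≤ β ^ B
      sy≤ = begin
        (sy * sy) ^ N          ≡⟨ ^-distrib-* sy sy N ⟩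
        sy ^ N * sy ^ N        ≡⟨ ^-homo-* sy N N ⟨
        sy ^ (N ℕ.+ N)         ≡⟨ cong (sy ^_) (exponent n) ⟩
        sy ^ ((1 ℕ.+ n) ℕ.* B) ≡⟨ ^-assocʳ sy (1 ℕ.+ n) B ⟨
        (sy ^ (1 ℕ.+ n)) ^ B   ≤⟨ ^-mono-≤ B (^-pos (1 ℕ.+ n) 0<sy) (<⇒≤ sy^<β) ⟩
        β ^ B                  ∎
        where
        exponent : ∀ n → n ℕ.* ((1 ℕ.+ n) ℕ.* (2 ℕ.+ n)) ℕ.+ n ℕ.* ((1 ℕ.+ n) ℕ.* (2 ℕ.+ n)) ≡
                         (1 ℕ.+ n) ℕ.* (2 ℕ.* (n ℕ.* (2 ℕ.+ n)))
        exponent = solve-∀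

      ≤tx : α ^ A ≤ tx ^ N
      ≤tx = subst (α ^ A ≤_) (^-assocʳ tx n A) (^-mono-≤ A 0<α (<⇒≤ α<tx^))

      ≤tz : γ ^ C ≤ tz ^ N
      ≤tz = subst (γ ^ C ≤_) (trans (^-assocʳ tz (2 ℕ.+ n) C) (cong (tz ^_) (exponent n)))
        (^-mono-≤ C 0<γ (<⇒≤ γ<tz^))
        where
        exponent : ∀ n → (2 ℕ.+ n) ℕ.* (n ℕ.* (1 ℕ.+ n)) ≡ n ℕ.* ((1 ℕ.+ n) ℕ.* (2 ℕ.+ n))
        exponent = solve-∀

  -- The rational t / s separates the quotients: y / x < t / s < r / t < z / y.
  quotient-< : ∀ (x y z : ℝ⁺) {s t r} → ℝ⁺.L x s → ℝ⁺.U y t → ℝ⁺.L z r → t * t < s * r →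
               y ÷ʳ x <ʳ z ÷ʳ y
  quotient-< x y z {s} {t} {r} Ls Ut Lr tt<sr = build (quotient t 0<s)
    where
    0<s = ℝ⁺.L-pos x Ls
    0<t = ℝ⁺.U-pos y Ut
    build : ∃[ q ] q * s ≡ t → y ÷ʳ x <ʳ z ÷ʳ y
    build (q , qs≡t) = q , (s , Ls , subst (ℝ⁺.U y) (sym qs≡t) Ut)
                         , (0<q , t , Ut , ℝ⁺.L-down z (0<*0< 0<q 0<t) qt<r Lr)
      where
      0<q : 0ℚ < q
      0<q = 0<-cancelʳ 0<s (subst (0ℚ <_) (sym qs≡t) 0<t)
      qt<r : q * t < r
      qt<r = *-cancelʳ-< 0<s (subst₂ _<_
        (trans (cong (t *_) (sym qs≡t)) (trans (x∙yz≈y∙xz t q s) (sym (*-assoc q t s)))) (*-comm s r) tt<sr)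

  module _ (n : ℕ) .{{_ : NonZero n}} {α β γ : ℚ} (0<α : 0ℚ < α) (0<β : 0ℚ < β) (0<γ : 0ℚ < γ) where

    private
      X = root n (fromℚ⁺ α 0<α)
      Y = root (1 ℕ.+ n) (fromℚ⁺ β 0<β)
      Z = root (2 ℕ.+ n) (fromℚ⁺ γ 0<γ)
      A = (1 ℕ.+ n) ℕ.* (2 ℕ.+ n)
      B = 2 ℕ.* (n ℕ.* (2 ℕ.+ n))
      C = n ℕ.* (1 ℕ.+ n)
      N = n ℕ.* A

      approximated : ∀ {Λ κ} → Λ * β ^ B ≡ α ^ A * γ ^ C → 1ℚ < κ → κ ^ (2 ℕ.* N ℕ.+ 2 ℕ.* N) < Λ →
        (∃[ s ] ∃[ t ] ℝ⁺.L X s × ℝ⁺.U X t × t ≤ κ * s) →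
        (∃[ s ] ∃[ t ] ℝ⁺.L Y s × ℝ⁺.U Y t × t ≤ κ * s) →
        (∃[ s ] ∃[ t ] ℝ⁺.L Z s × ℝ⁺.U Z t × t ≤ κ * s) →
        Y ÷ʳ X <ʳ Z ÷ʳ Y
      approximated Λβ≡ 1<κ κ^<Λ
        (sx , tx , Lsx@(0<sx , _ , _) , (0<tx , α<tx^) , tx≤)
        (sy , ty , (0<sy , _ , sy^<β) , Uty@(0<ty , _) , ty≤)
        (sz , tz , Lsz@(0<sz , _ , _) , (0<tz , γ<tz^) , tz≤) =
        quotient-< X Y Z Lsx Uty Lsz
          (approximants-< n 0<α 0<γ (<-trans 0<1 1<κ) 0<sx 0<tx 0<sy 0<ty 0<sz 0<tz
            α<tx^ sy^<β γ<tz^ tx≤ ty≤ tz≤ κ^<Λ Λβ≡)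

      slack : (∃[ Λ ] Λ * β ^ B ≡ α ^ A * γ ^ C) → β ^ B < α ^ A * γ ^ C →
              ∃[ Λ ] Λ * β ^ B ≡ α ^ A * γ ^ C × ∃[ κ ] 1ℚ < κ × κ ^ (2 ℕ.* N ℕ.+ 2 ℕ.* N) < Λ
      slack (Λ , Λβ≡) lt = Λ , Λβ≡ , 1<⇒^-< (2 ℕ.* N ℕ.+ 2 ℕ.* N)
        (*-cancelʳ-< (^-pos B 0<β) (subst₂ _<_ (sym (*-identityˡ (β ^ B))) (sym Λβ≡) lt))

      conclude : (∃[ Λ ] Λ * β ^ B ≡ α ^ A * γ ^ C × ∃[ κ ] 1ℚ < κ × κ ^ (2 ℕ.* N ℕ.+ 2 ℕ.* N) < Λ) →
                 Y ÷ʳ X <ʳ Z ÷ʳ Y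
      conclude (Λ , Λβ≡ , κ , 1<κ , κ^<Λ) = approximated Λβ≡ 1<κ κ^<Λ
        (approximate-≤ X 1<κ) (approximate-≤ Y 1<κ) (approximate-≤ Z 1<κ)

    -- The hypothesis is Y² < X Z raised to the power N = n (n+1) (n+2). The slack Λ > 1 is the
    -- quotient of its two sides.
    root-quotient-< : β ^ B < α ^ A * γ ^ C → Y ÷ʳ X <ʳ Z ÷ʳ Y
    root-quotient-< lt = conclude (slack (quotient (α ^ A * γ ^ C) (^-pos B 0<β)) lt)

  -- From log-convex ratios to log-convex roots

  module _ (a : ℕ → ℚ) (0<a : ∀ n → 0ℚ < a n) (1≤a₀ : 1ℚ ≤ a 0)
    (ratio-log-convex : ∀ n → a n * a (2 ℕ.+ n) ^ 3 < a (3 ℕ.+ n) * a (1 ℕ.+ n) ^ 3) where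

    private
      A B C : ℕ → ℕ
      A n = (1 ℕ.+ n) ℕ.* (2 ℕ.+ n)
      B n = 2 ℕ.* (n ℕ.* (2 ℕ.+ n))
      C n = n ℕ.* (1 ℕ.+ n)

    -- The inequality F(n) < F(n+1) in multiplicative form: the ratio inequality raised to the power
    -- A n is multiplied by the hypothesis. The exponents match through B (n+1) + C n = 3 A n = A
    -- (n+1) + B n and C (n+1) = A n. The hypothesis is non-strict so that n = 0 can serve as the
    -- start.
    step : ∀ n → a (1 ℕ.+ n) ^ B n ≤ a n ^ A n * a (2 ℕ.+ n) ^ C n →
           a (2 ℕ.+ n) ^ B (1 ℕ.+ n) < a (1 ℕ.+ n) ^ A (1 ℕ.+ n) * a (3 ℕ.+ n) ^ C (1 ℕ.+ n)
    step n ih = *-cancelʳ-< (0<*0< (^-pos (A n) (0<a n)) (^-pos (C n) (0<a (2 ℕ.+ n)))) (begin-strict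
      z ^ B (1 ℕ.+ n) * (x ^ A n * z ^ C n) ≡⟨ x∙yz≈y∙xz (z ^ B (1 ℕ.+ n)) (x ^ A n) (z ^ C n) ⟩
      x ^ A n * (z ^ B (1 ℕ.+ n) * z ^ C n) ≡⟨ cong (x ^ A n *_) (^-homo-* z (B (1 ℕ.+ n)) (C n)) ⟨
      x ^ A n * z ^ (B (1 ℕ.+ n) ℕ.+ C n)   ≡⟨ cong (λ e → x ^ A n * z ^ e) (exponent₁ n) ⟩
      x ^ A n * z ^ (3 ℕ.* A n)             ≡⟨ cong (x ^ A n *_) (^-assocʳ z 3 (A n)) ⟨
      x ^ A n * (z ^ 3) ^ A n               ≡⟨ ^-distrib-* x (z ^ 3) (A n) ⟨
      (x * z ^ 3) ^ A n                     <⟨ ^-mono-< (A n) (0<*0< (0<a n) (^-pos 3 (0<a (2 ℕ.+ n)))) (ratio-log-convex n) ⟩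
      (t * y ^ 3) ^ A n                     ≡⟨ ^-distrib-* t (y ^ 3) (A n) ⟩
      t ^ A n * (y ^ 3) ^ A n               ≡⟨ cong (t ^ A n *_) (^-assocʳ y 3 (A n)) ⟩
      t ^ A n * y ^ (3 ℕ.* A n)             ≡⟨ cong (λ e → t ^ A n * y ^ e) (exponent₂ n) ⟩
      t ^ A n * y ^ (A (1 ℕ.+ n) ℕ.+ B n)   ≡⟨ cong (t ^ A n *_) (^-homo-* y (A (1 ℕ.+ n)) (B n)) ⟩
      t ^ A n * (y ^ A (1 ℕ.+ n) * y ^ B n) ≡⟨ x∙yz≈y∙xz (t ^ A n) (y ^ A (1 ℕ.+ n)) (y ^ B n) ⟩
      y ^ A (1 ℕ.+ n) * (t ^ A n * y ^ B n) ≡⟨ *-assoc (y ^ A (1 ℕ.+ n)) (t ^ A n) (y ^ B n) ⟨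
      y ^ A (1 ℕ.+ n) * t ^ A n * y ^ B n          ≤⟨ *-mono-≤-pos (0<*0< (^-pos (A (1 ℕ.+ n)) (0<a (1 ℕ.+ n))) (^-pos (A n) (0<a (3 ℕ.+ n))))
                                                        (^-pos (B n) (0<a (1 ℕ.+ n))) ≤-refl ih ⟩
      y ^ A (1 ℕ.+ n) * t ^ A n * (x ^ A n * z ^ C n) ∎)
      where
      open ≤-Reasoning
      x = a n
      y = a (1 ℕ.+ n)
      z = a (2 ℕ.+ n)
      t = a (3 ℕ.+ n)
      exponent₁ : ∀ n → 2 ℕ.* ((1 ℕ.+ n) ℕ.* (3 ℕ.+ n)) ℕ.+ n ℕ.* (1 ℕ.+ n) ≡ 3 ℕ.* ((1 ℕ.+ n) ℕ.* (2 ℕ.+ n))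
      exponent₁ = solve-∀
      exponent₂ : ∀ n → 3 ℕ.* ((1 ℕ.+ n) ℕ.* (2 ℕ.+ n)) ≡ (2 ℕ.+ n) ℕ.* (3 ℕ.+ n) ℕ.+ 2 ℕ.* (n ℕ.* (2 ℕ.+ n))
      exponent₂ = solve-∀

    -- At n = 0 the exponents A, B, C are 2, 0, 0, which leaves 1 ≤ a(0)².
    base : a 1 ^ B 0 ≤ a 0 ^ A 0 * a 2 ^ C 0
    base = subst (1ℚ ≤_) (sym (*-identityʳ (a 0 ^ 2)))
      (subst (_≤ a 0 ^ 2) (1^n≡1 2) (^-mono-≤ 2 0<1 1≤a₀))

    powers : ∀ n → .{{_ : NonZero n}} → a (1 ℕ.+ n) ^ B n < a n ^ A n * a (2 ℕ.+ n) ^ C n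
    powers 1             = step 0 base
    powers (suc (suc n)) = step (suc n) (<⇒≤ (powers (suc n)))

    roots-strictlyLogConvex : StrictlyLogConvex (λ n → root n (fromℚ⁺ (a n) (0<a n)))
    roots-strictlyLogConvex n = root-quotient-< n (0<a n) (0<a (1 ℕ.+ n)) (0<a (2 ℕ.+ n)) (powers n)

  -- From the integer sums to the rational numbers d_i(m)

  fromℕ≡/1 : ∀ n → (+ n) / 1 ≡ fromℕ n
  fromℕ≡/1 n = ↥p/↧p≡p (fromℕ n)

  fromℕ-homo-* : ∀ m n → fromℕ (m ℕ.* n) ≡ fromℕ m * fromℕ n
  fromℕ-homo-* m n = trans (sym (fromℕ≡/1 (m ℕ.* n))) (cong (_/ 1) (ℤ.pos-* m n))

  fromℕ-mono-≤ : ∀ {m n} → m ℕ.≤ n → fromℕ m ≤ fromℕ n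
  fromℕ-mono-≤ {m} {n} m≤n = *≤* (ℤ.*-monoʳ-≤-nonNeg (+ 1) (ℤ.+≤+ m≤n))

  fromℕ-mono-< : ∀ {m n} → m ℕ.< n → fromℕ m < fromℕ n
  fromℕ-mono-< {m} {n} m<n = *<* (ℤ.*-monoʳ-<-pos (+ 1) (ℤ.+<+ m<n))

  /-* : ∀ n c .{{_ : NonZero c}} → (+ n) / c * fromℕ c ≡ fromℕ n
  /-* n (suc c) = toℚᵘ-injective (ℚᵘ.≃-trans (toℚᵘ-homo-* ((+ n) / suc c) (fromℕ (suc c)))
    (ℚᵘ.≃-trans (ℚᵘ.*-congʳ {mkℚᵘ (+ suc c) 0} (toℚᵘ-fromℚᵘ (mkℚᵘ (+ n) c)))
      (*≡* (trans (ℤ.*-identityʳ _) (cong (λ s → + n ℤ.* + s) (sym (ℕ.*-identityʳ (suc c))))))))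

  module _ (p : ℕ) where

    private
      i = suc p

      a : ℕ → ℚ
      a n = d i (i ℕ.+ n)

      D P : ℕ → ℕ
      D n = dSum i (i ℕ.+ n)
      P n = 2 ℕ.^ (2 ℕ.* (i ℕ.+ n))

      a*P≡D : ∀ n → a n * fromℕ (P n) ≡ fromℕ (D n)
      a*P≡D n = /-* (D n) (P n) {{ℕ.m^n≢0 2 (2 ℕ.* (i ℕ.+ n))}}

      0<P : ∀ n → 0ℚ < fromℕ (P n)
      0<P n = fromℕ-mono-< (ℕ.m^n>0 2 (2 ℕ.* (i ℕ.+ n)))

    1≤d₀ : 1ℚ ≤ a 0
    1≤d₀ = *-cancelʳ-≤-pos (fromℕ (P 0)) {{positive (0<P 0)}}
      (subst₂ _≤_ (sym (*-identityˡ (fromℕ (P 0)))) (sym (a*P≡D 0)) (fromℕ-mono-≤ (4^i≤dSum i)))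

    -- The denominators 4^m cancel: both sides carry the same total exponent, since m + 3 (m+2) =
    -- (m+3) + 3 (m+1).
    d-ratio-log-convex : ∀ n → a n * a (2 ℕ.+ n) ^ 3 < a (3 ℕ.+ n) * a (1 ℕ.+ n) ^ 3
    d-ratio-log-convex n = *-cancelʳ-< (0<*0< (0<P n) (^-pos 3 (0<P (2 ℕ.+ n)))) (subst₂ _<_
        (sym (scaled n (2 ℕ.+ n)))
        (trans (sym (scaled (3 ℕ.+ n) (1 ℕ.+ n))) (cong (a (3 ℕ.+ n) * a (1 ℕ.+ n) ^ 3 *_) powers≡))
        (fromℕ-mono-< (dSum-ratio-log-convex p n)))
      where
      open ≡-Reasoning
      cube : ∀ m → fromℕ (m ℕ.* (m ℕ.* m)) ≡ fromℕ m ^ 3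
      cube m = trans (fromℕ-homo-* m (m ℕ.* m)) (cong (fromℕ m *_)
        (trans (fromℕ-homo-* m m) (cong (fromℕ m *_) (sym (*-identityʳ (fromℕ m))))))
      scaled : ∀ k l → a k * a l ^ 3 * (fromℕ (P k) * fromℕ (P l) ^ 3) ≡ fromℕ (D k ℕ.* (D l ℕ.* (D l ℕ.* D l)))
      scaled k l = begin
        a k * a l ^ 3 * (fromℕ (P k) * fromℕ (P l) ^ 3) ≡⟨ interchange (a k) (a l ^ 3) (fromℕ (P k)) (fromℕ (P l) ^ 3) ⟩
        a k * fromℕ (P k) * (a l ^ 3 * fromℕ (P l) ^ 3) ≡⟨ cong (a k * fromℕ (P k) *_) (^-distrib-* (a l) (fromℕ (P l)) 3) ⟨
        a k * fromℕ (P k) * (a l * fromℕ (P l)) ^ 3     ≡⟨ cong₂ (λ s t → s * t ^ 3) (a*P≡D k) (a*P≡D l) ⟩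
        fromℕ (D k) * fromℕ (D l) ^ 3                   ≡⟨ cong (fromℕ (D k) *_) (cube (D l)) ⟨
        fromℕ (D k) * fromℕ (D l ℕ.* (D l ℕ.* D l))     ≡⟨ fromℕ-homo-* (D k) (D l ℕ.* (D l ℕ.* D l)) ⟨
        fromℕ (D k ℕ.* (D l ℕ.* (D l ℕ.* D l)))         ∎
      P-suc : ∀ k → P (suc k) ≡ 4 ℕ.* P k
      P-suc k = trans (cong (2 ℕ.^_) (exponent i k)) (ℕ.^-distribˡ-+-* 2 2 (2 ℕ.* (i ℕ.+ k)))
        where
        exponent : ∀ i k → 2 ℕ.* (i ℕ.+ suc k) ≡ 2 ℕ.+ 2 ℕ.* (i ℕ.+ k)
        exponent = solve-∀
      powers≡ : fromℕ (P (3 ℕ.+ n)) * fromℕ (P (1 ℕ.+ n)) ^ 3 ≡ fromℕ (P n) * fromℕ (P (2 ℕ.+ n)) ^ 3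
      powers≡ = begin
        fromℕ (P (3 ℕ.+ n)) * fromℕ P₁ ^ 3               ≡⟨ cong (fromℕ (P (3 ℕ.+ n)) *_) (cube P₁) ⟨
        fromℕ (P (3 ℕ.+ n)) * fromℕ (P₁ ℕ.* (P₁ ℕ.* P₁)) ≡⟨ fromℕ-homo-* (P (3 ℕ.+ n)) (P₁ ℕ.* (P₁ ℕ.* P₁)) ⟨
        fromℕ (P (3 ℕ.+ n) ℕ.* (P₁ ℕ.* (P₁ ℕ.* P₁)))     ≡⟨ cong fromℕ equal ⟩
        fromℕ (P n ℕ.* (P₂ ℕ.* (P₂ ℕ.* P₂)))             ≡⟨ fromℕ-homo-* (P n) (P₂ ℕ.* (P₂ ℕ.* P₂)) ⟩
        fromℕ (P n) * fromℕ (P₂ ℕ.* (P₂ ℕ.* P₂))         ≡⟨ cong (fromℕ (P n) *_) (cube P₂) ⟩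
        fromℕ (P n) * fromℕ P₂ ^ 3                       ∎
        where
        P₁ = P (1 ℕ.+ n)
        P₂ = P (2 ℕ.+ n)
        identity : ∀ q → 4 ℕ.* (4 ℕ.* (4 ℕ.* q)) ℕ.* (4 ℕ.* q ℕ.* (4 ℕ.* q ℕ.* (4 ℕ.* q))) ≡
          q ℕ.* (4 ℕ.* (4 ℕ.* q) ℕ.* (4 ℕ.* (4 ℕ.* q) ℕ.* (4 ℕ.* (4 ℕ.* q))))
        identity = solve-∀
        equal : P (3 ℕ.+ n) ℕ.* (P₁ ℕ.* (P₁ ℕ.* P₁)) ≡ P n ℕ.* (P₂ ℕ.* (P₂ ℕ.* P₂))
        equal rewrite P-suc (2 ℕ.+ n) | P-suc (1 ℕ.+ n) | P-suc n = identity (P n)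

open Rationals

theorem5p2 : (i : ℕ) → .{{NonZero i}} →
    StrictlyLogConvex (λ n → root n (fromℚ⁺ (d i (i + n)) (0<d (m≤m+n i n))))
theorem5p2 i@(suc p) = roots-strictlyLogConvex
  (λ n → d i (i + n)) (λ n → 0<d (m≤m+n i n)) (1≤d₀ p) (d-ratio-log-convex p)
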